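{- Let $f_k=\prod_{j=1}^{\infty}(1-q^{kj})$ and let $p_8(n)$ be defined by $\sum_{n\ge0}p_8(n)q^n=1/f_1^8$. Then \[\sum_{n=0}^{\infty}p_8(2n+1)q^n = 8\frac{f_2^{16}}{f_1^{24}},\qquad \sum_{n=0}^{\infty}p_8(4n+3)q^n = 192\frac{f_2^{24}}{f_1^{32}} + 16384\, q\, \frac{f_2^{48}}{f_1^{56}}.\] -}

module Defs where

open import Data.Nat using (ℕ; zero; suc; _∸_; _≡ᵇ_) renaming (_*_ to _*ℕ_)
open import Data.Integer using (ℤ; +_; _+_; _-_; _*_; -_)
open import Data.Bool using (if_then_else_)

-- Formal power series in q with integer coefficients: n ↦ coefficient of q^n.
Series : Set
Series = ℕ → ℤ

sumTo : ℕ → (ℕ → ℤ) → ℤ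
sumTo zero    g = g zero
sumTo (suc n) g = sumTo n g + g (suc n)

mono : ℕ → Series
mono d n = if n ≡ᵇ d then + 1 else + 0

one : Series
one = mono 0

q : Series
q = mono 1

infixl 6 _⊕_ _⊖_
infixl 7 _⊛_

_⊕_ : Series → Series → Series
(a ⊕ b) n = a n + b n

_⊖_ : Series → Series → Series
(a ⊖ b) n = a n - b n

scale : ℤ → Series → Series
scale c a n = c * a n

_⊛_ : Series → Series → Series
(a ⊛ b) n = sumTo n (λ i → a i * b (n ∸ i))

pow : Series → ℕ → Series
pow a zero    = one
pow a (suc m) = a ⊛ pow a m

prodTrunc : ℕ → ℕ → Series
prodTrunc k zero    = one
prodTrunc k (suc m) = prodTrunc k m ⊛ (one ⊖ mono (k *ℕ suc m))

-- f_k = ∏_{j≥1} (1 - q^{k j})  (for k ≥ 1): the coefficient of q^n is that of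
-- the truncated product up to j = n, since factors with j > n do not affect
-- coefficients of degree ≤ n.
f : ℕ → Series
f k n = prodTrunc k n n

-- Inverse of a series a with constant term 1: 1/a = 1/(1-g) = Σ_{m≥0} g^m with
-- g = 1 - a having zero constant term, so only m ≤ n contributes to q^n.
inv : Series → Series
inv a n = sumTo n (λ m → pow (one ⊖ a) m n)

p8 : Series
p8 = inv (pow (f 1) 8)

{-# OPTIONS --safe #-}
-- Write f₄ for f₂(q²), φ(q) = Σ_{j ∈ ℤ} q^{j²}, and x = 1/f₁⁸, y = x(-q).  Gauss's identity
-- f₂ φ(-q) = f₁² comes from Shanks' finite form of it, and f₁ f₁(-q) f₄ = f₂³ from regrouping
-- factors.  These give φ(q)φ(-q) = φ(-q²)², while φ(q) + φ(-q) = 2φ(q⁴) is clear.  Hence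
-- D = φ(q)² + φ(-q)² - 2φ(q²)² satisfies D(q) = -2D(q²), so D = 0, and then E = φ(q)⁴ - φ(-q)⁴
-- satisfies E(q)² = 16 φ(q²)⁴ E(q²).  After clearing denominators, 16 q f₄⁸ solves the same
-- equation as f₁(-q)⁸ - f₁(q)⁸ with the same leading coefficient, and such a solution is
-- unique: this is Jacobi's identity f₁(-q)⁸ - f₁(q)⁸ = 16 q f₄⁸.  So x - y = 16 q f₄¹⁶/f₂²⁴
-- and xy = f₄⁸/f₂²⁴.  The first is twice the odd part of x; twice the odd part of f₂¹⁶x³ is
-- f₂¹⁶(x - y)((x - y)² + 3xy).
module Submission where

-- The equation for E is quadratic because E changes sign when φ(q) and φ(-q) are exchanged, while
-- only φ(q)φ(-q) and φ(q)² + φ(-q)² are known as series in q². The zero series solves it too, so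
-- some initial coefficient has to be supplied. Subtracting the equations of two solutions J and T
-- and factoring J² - T² leaves an equation that is linear in J - T; substituting q² doubles the
-- order of J - T, whereas multiplying by J + T raises it by only one, and this conflict forces J =
-- T. The constant 16 is dictated by the equation: c q f₄⁸ solves it only if c² = 16c. No infinite
-- product is manipulated directly. Each product identity is an identity of finite products,
-- transferred to the series modulo q^(N+1) for every N.

open import Defs
open import Algebra.Bundles using (CommutativeRing; RawRing)
import Algebra.Solver.Ring as RingSolver
open import Algebra.Solver.Ring.AlmostCommutativeRing using (fromCommutativeRing; _-Raw-AlmostCommutative⟶_)
open import Data.Nat as ℕ using (ℕ; zero; suc; _+_; _*_; _∸_; _≤_; _<_; z≤n; s≤s)
import Data.Nat.Properties as ℕ
open import Data.Integer using (ℤ; +_; ≢-nonZero) renaming (_+_ to _+ᶻ_; _*_ to _*ᶻ_; -_ to -ᶻ_; _-_ to _-ᶻ_)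
import Data.Integer.Properties as ℤ
open import Algebra.Properties.CommutativeSemigroup ℤ.+-commutativeSemigroup using (interchange)
open import Data.Maybe using (Maybe; just; nothing)
open import Data.Product using (_×_; _,_)
open import Data.Sum using (_⊎_; inj₁; inj₂)
open import Level using (0ℓ)
open import Relation.Binary.Bundles using (Setoid)
import Relation.Binary.Reasoning.Setoid as SetoidReasoning
open import Relation.Binary.PropositionalEquality using (_≡_; _≢_; refl; sym; trans; cong; cong₂; module ≡-Reasoning)
open import Relation.Nullary using (yes; no; contradiction)

module ≡ = ≡-Reasoning

-- The ring of power series

infix 4 _≈_

-- A record rather than bare pointwise equality, so that both series can be inferred from the type;
-- unification cannot in general recover them from `a n ≡ b n`.
record _≈_ (a b : Series) : Set where
  constructor coeffs
  field coeff : ∀ n → a n ≡ b n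

open _≈_

private variable
  a b c d : Series

≈-refl : a ≈ a
≈-refl = coeffs λ _ → refl

≈-sym : a ≈ b → b ≈ a
≈-sym p = coeffs λ n → sym (coeff p n)

≈-trans : a ≈ b → b ≈ c → a ≈ c
≈-trans p r = coeffs λ n → trans (coeff p n) (coeff r n)

≡⇒≈ : a ≡ b → a ≈ b
≡⇒≈ refl = ≈-refl

sumTo-cong≤ : ∀ n {g h : ℕ → ℤ} → (∀ i → i ≤ n → g i ≡ h i) → sumTo n g ≡ sumTo n h
sumTo-cong≤ zero    p = p 0 z≤n
sumTo-cong≤ (suc n) p =
  cong₂ _+ᶻ_ (sumTo-cong≤ n λ i i≤n → p i (ℕ.m≤n⇒m≤1+n i≤n)) (p (suc n) ℕ.≤-refl)

sumTo-0 : ∀ n → sumTo n (λ _ → + 0) ≡ + 0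
sumTo-0 zero    = refl
sumTo-0 (suc n) = trans (ℤ.+-identityʳ _) (sumTo-0 n)

sumTo-+ : ∀ n (g h : ℕ → ℤ) → sumTo n (λ i → g i +ᶻ h i) ≡ sumTo n g +ᶻ sumTo n h
sumTo-+ zero    g h = refl
sumTo-+ (suc n) g h = trans (cong (_+ᶻ (g (suc n) +ᶻ h (suc n))) (sumTo-+ n g h))
                            (interchange (sumTo n g) (sumTo n h) (g (suc n)) (h (suc n)))

sumTo-* : ∀ n k (g : ℕ → ℤ) → sumTo n (λ i → k *ᶻ g i) ≡ k *ᶻ sumTo n g
sumTo-* zero    k g = refl
sumTo-* (suc n) k g = trans (cong (_+ᶻ k *ᶻ g (suc n)) (sumTo-* n k g))
                            (sym (ℤ.*-distribˡ-+ k (sumTo n g) (g (suc n))))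

sumTo-shift : ∀ n (g : ℕ → ℤ) → sumTo (suc n) g ≡ g 0 +ᶻ sumTo n (λ i → g (suc i))
sumTo-shift zero    g = refl
sumTo-shift (suc n) g = trans (cong (_+ᶻ g (suc (suc n))) (sumTo-shift n g)) (ℤ.+-assoc (g 0) _ _)

tail : Series → Series
tail a n = a (suc n)

-- From a = a₀ + q · `tail a`. This recursion lets commutativity, associativity and the two
-- substitutions be handled by induction on the degree, without rearranging double sums.
⊛-suc : ∀ a b n → (a ⊛ b) (suc n) ≡ a 0 *ᶻ b (suc n) +ᶻ (tail a ⊛ b) n
⊛-suc a b n = sumTo-shift n (λ i → a i *ᶻ b (suc n ∸ i))

⊛-sucʳ : ∀ a b n → (a ⊛ b) (suc n) ≡ (a ⊛ tail b) n +ᶻ a (suc n) *ᶻ b 0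
⊛-sucʳ a b n = cong₂ _+ᶻ_
  (sumTo-cong≤ n λ i i≤n → cong (λ j → a i *ᶻ b j) (ℕ.+-∸-assoc 1 i≤n))
  (cong (λ j → a (suc n) *ᶻ b j) (ℕ.n∸n≡0 n))

zeroS : Series
zeroS _ = + 0

neg : Series → Series
neg a n = -ᶻ a n

const : ℤ → Series
const k zero    = k
const k (suc _) = + 0

⊕-cong : a ≈ b → c ≈ d → a ⊕ c ≈ b ⊕ d
⊕-cong p r = coeffs λ n → cong₂ _+ᶻ_ (coeff p n) (coeff r n)

⊖-cong : a ≈ b → c ≈ d → a ⊖ c ≈ b ⊖ d
⊖-cong p r = coeffs λ n → cong₂ _-ᶻ_ (coeff p n) (coeff r n)

neg-cong : a ≈ b → neg a ≈ neg b
neg-cong p = coeffs λ n → cong -ᶻ_ (coeff p n)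

⊛-cong : a ≈ b → c ≈ d → a ⊛ c ≈ b ⊛ d
⊛-cong p r = coeffs λ n → sumTo-cong≤ n λ i _ → cong₂ _*ᶻ_ (coeff p i) (coeff r (n ∸ i))

⊛-comm : ∀ a b → a ⊛ b ≈ b ⊛ a
⊛-comm a b = coeffs (go a b)
  where
  go : ∀ a b n → (a ⊛ b) n ≡ (b ⊛ a) n
  go a b zero    = ℤ.*-comm (a 0) (b 0)
  go a b (suc n) = begin
    (a ⊛ b) (suc n)                            ≡⟨ ⊛-suc a b n ⟩
    a 0 *ᶻ b (suc n) +ᶻ (tail a ⊛ b) n       ≡⟨ ℤ.+-comm (a 0 *ᶻ b (suc n)) _ ⟩
    (tail a ⊛ b) n +ᶻ a 0 *ᶻ b (suc n)       ≡⟨ cong₂ _+ᶻ_ (go (tail a) b n) (ℤ.*-comm (a 0) (b (suc n))) ⟩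
    (b ⊛ tail a) n +ᶻ b (suc n) *ᶻ a 0       ≡⟨ ⊛-sucʳ b a n ⟨
    (b ⊛ a) (suc n)                            ∎
    where open ≡

⊛-distribʳ : ∀ c a b → (a ⊕ b) ⊛ c ≈ (a ⊛ c) ⊕ (b ⊛ c)
⊛-distribʳ c a b = coeffs λ n →
  trans (sumTo-cong≤ n λ i _ → ℤ.*-distribʳ-+ (c (n ∸ i)) (a i) (b i)) (sumTo-+ n _ _)

scale-⊛ : ∀ k a b → scale k a ⊛ b ≈ scale k (a ⊛ b)
scale-⊛ k a b = coeffs λ n →
  trans (sumTo-cong≤ n λ i _ → ℤ.*-assoc k (a i) (b (n ∸ i))) (sumTo-* n k _)

⊛-assoc : ∀ a b c → (a ⊛ b) ⊛ c ≈ a ⊛ (b ⊛ c)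
⊛-assoc a b c = coeffs (go a b c)
  where
  go : ∀ a b c n → ((a ⊛ b) ⊛ c) n ≡ (a ⊛ (b ⊛ c)) n
  go a b c zero    = ℤ.*-assoc (a 0) (b 0) (c 0)
  go a b c (suc n) = begin
    ((a ⊛ b) ⊛ c) (suc n)
      ≡⟨ ⊛-suc (a ⊛ b) c n ⟩
    a 0 *ᶻ b 0 *ᶻ c (suc n) +ᶻ (tail (a ⊛ b) ⊛ c) n
      ≡⟨ cong₂ _+ᶻ_ (ℤ.*-assoc (a 0) (b 0) (c (suc n)))
                     (coeff (⊛-cong {c = c} (coeffs (⊛-suc a b)) ≈-refl) n) ⟩
    a₀bc +ᶻ ((scale (a 0) (tail b) ⊕ (tail a ⊛ b)) ⊛ c) n
      ≡⟨ cong (a₀bc +ᶻ_) (coeff (⊛-distribʳ c (scale (a 0) (tail b)) (tail a ⊛ b)) n) ⟩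
    a₀bc +ᶻ ((scale (a 0) (tail b) ⊛ c) n +ᶻ ((tail a ⊛ b) ⊛ c) n)
      ≡⟨ cong (a₀bc +ᶻ_) (cong₂ _+ᶻ_ (coeff (scale-⊛ (a 0) (tail b) c) n) (go (tail a) b c n)) ⟩
    a₀bc +ᶻ (a 0 *ᶻ (tail b ⊛ c) n +ᶻ (tail a ⊛ (b ⊛ c)) n)
      ≡⟨ ℤ.+-assoc a₀bc _ _ ⟨
    a₀bc +ᶻ a 0 *ᶻ (tail b ⊛ c) n +ᶻ (tail a ⊛ (b ⊛ c)) n
      ≡⟨ cong (_+ᶻ (tail a ⊛ (b ⊛ c)) n) (ℤ.*-distribˡ-+ (a 0) (b 0 *ᶻ c (suc n)) ((tail b ⊛ c) n)) ⟨
    a 0 *ᶻ (b 0 *ᶻ c (suc n) +ᶻ (tail b ⊛ c) n) +ᶻ (tail a ⊛ (b ⊛ c)) n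
      ≡⟨ cong (λ t → a 0 *ᶻ t +ᶻ (tail a ⊛ (b ⊛ c)) n) (⊛-suc b c n) ⟨
    a 0 *ᶻ (b ⊛ c) (suc n) +ᶻ (tail a ⊛ (b ⊛ c)) n
      ≡⟨ ⊛-suc a (b ⊛ c) n ⟨
    (a ⊛ (b ⊛ c)) (suc n) ∎
    where
    open ≡
    a₀bc = a 0 *ᶻ (b 0 *ᶻ c (suc n))

const-⊛ : ∀ k a → const k ⊛ a ≈ scale k a
const-⊛ k a = coeffs go
  where
  go : ∀ n → (const k ⊛ a) n ≡ k *ᶻ a n
  go zero    = refl
  go (suc n) = trans (⊛-suc (const k) a n)
                     (trans (cong (k *ᶻ a (suc n) +ᶻ_) (sumTo-0 n)) (ℤ.+-identityʳ _))

const-1 : const (+ 1) ≈ one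
const-1 = coeffs λ { zero → refl ; (suc n) → refl }

⊛-identityˡ : ∀ a → one ⊛ a ≈ a
⊛-identityˡ a = ≈-trans (⊛-cong {c = a} (≈-sym const-1) ≈-refl)
  (≈-trans (const-⊛ (+ 1) a) (coeffs λ n → ℤ.*-identityˡ (a n)))

-- The opaque copy of _⊛_ keeps the unifier from unfolding products to sums of coefficients.
infixl 7 _·_

opaque
  _·_ : Series → Series → Series
  _·_ = _⊛_

  ⊛≈· : ∀ a b → a ⊛ b ≈ a · b
  ⊛≈· a b = ≈-refl

·-cong : a ≈ b → c ≈ d → a · c ≈ b · d
·-cong {a} {b} {c} {d} p r = ≈-trans (≈-sym (⊛≈· a c)) (≈-trans (⊛-cong p r) (⊛≈· b d))

·-comm : ∀ a b → a · b ≈ b · a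
·-comm a b = ≈-trans (≈-sym (⊛≈· a b)) (≈-trans (⊛-comm a b) (⊛≈· b a))

opaque
  unfolding _·_

  ·-assoc : ∀ a b c → (a · b) · c ≈ a · (b · c)
  ·-assoc = ⊛-assoc

  ·-distribʳ : ∀ c a b → (a ⊕ b) · c ≈ (a · c) ⊕ (b · c)
  ·-distribʳ = ⊛-distribʳ

  ·-identityˡ : ∀ a → one · a ≈ a
  ·-identityˡ = ⊛-identityˡ

  const-· : ∀ k a → const k · a ≈ scale k a
  const-· = const-⊛

  ·-zero : ∀ a b → (a · b) 0 ≡ a 0 *ᶻ b 0
  ·-zero a b = refl

  ·-suc : ∀ a b n → (a · b) (suc n) ≡ a 0 *ᶻ b (suc n) +ᶻ (tail a · b) n
  ·-suc = ⊛-suc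

seriesRing : CommutativeRing 0ℓ 0ℓ
seriesRing = record
  { Carrier = Series ; _≈_ = _≈_ ; _+_ = _⊕_ ; _*_ = _·_ ; -_ = neg ; 0# = zeroS ; 1# = one
  ; isCommutativeRing = record
    { isRing = record
      { +-isAbelianGroup = record
        { isGroup = record
          { isMonoid = record
            { isSemigroup = record
              { isMagma = record
                { isEquivalence = record { refl = ≈-refl ; sym = ≈-sym ; trans = ≈-trans }
                ; ∙-cong = ⊕-cong }
              ; assoc = λ a b c → coeffs λ n → ℤ.+-assoc (a n) (b n) (c n) }
            ; identity = (λ a → coeffs λ n → ℤ.+-identityˡ (a n))
                       , (λ a → coeffs λ n → ℤ.+-identityʳ (a n)) }
          ; inverse = (λ a → coeffs λ n → ℤ.+-inverseˡ (a n))
                    , (λ a → coeffs λ n → ℤ.+-inverseʳ (a n))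
          ; ⁻¹-cong = neg-cong }
        ; comm = λ a b → coeffs λ n → ℤ.+-comm (a n) (b n) }
      ; *-cong = ·-cong
      ; *-assoc = ·-assoc
      ; *-identity = ·-identityˡ , λ a → ≈-trans (·-comm a one) (·-identityˡ a)
      ; distrib = (λ c a b → ≈-trans (·-comm c (a ⊕ b))
                               (≈-trans (·-distribʳ c a b) (⊕-cong (·-comm a c) (·-comm b c))))
                , ·-distribʳ }
    ; *-comm = ·-comm } }

open CommutativeRing seriesRing using () renaming (*-identityʳ to ·-identityʳ; zeroʳ to ·-zeroʳ; distribˡ to ·-distribˡ)

ℤ-rawRing : RawRing 0ℓ 0ℓ
ℤ-rawRing = CommutativeRing.rawRing ℤ.+-*-commutativeRing

const-morphism : ℤ-rawRing -Raw-AlmostCommutative⟶ fromCommutativeRing seriesRing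
const-morphism = record
  { ⟦_⟧    = const
  ; +-homo = λ _ _ → coeffs λ { zero → refl ; (suc _) → refl }
  ; *-homo = λ k l → ≈-sym (≈-trans (const-· k (const l))
                       (coeffs λ { zero → refl ; (suc _) → ℤ.*-zeroʳ k }))
  ; -‿homo = λ _ → coeffs λ { zero → refl ; (suc _) → refl }
  ; 0-homo = coeffs λ { zero → refl ; (suc _) → refl }
  ; 1-homo = const-1
  }

const-≟ : ∀ k l → Maybe (const k ≈ const l)
const-≟ k l with k ℤ.≟ l
... | yes refl = just ≈-refl
... | no _     = nothing

open RingSolver ℤ-rawRing (fromCommutativeRing seriesRing) const-morphism const-≟
  using (solve; con; _:=_; _:+_; _:*_; _:-_; :-_; _:^_; Polynomial)


-- A power rather than con (+ 1), because it must evaluate to `one` definitionally.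
:1 : ∀ {n} → Polynomial n
:1 = con (+ 1) :^ 0

open import Algebra.Properties.CommutativeSemiring.Exp (CommutativeRing.commutativeSemiring seriesRing)
  using (_^_; ^-congˡ; ^-distrib-*; ^-assocʳ)
open import Relation.Binary.Reasoning.Setoid (CommutativeRing.setoid seriesRing)

pow≈^ : ∀ a n → pow a n ≈ a ^ n
pow≈^ a zero    = ≈-refl
pow≈^ a (suc n) = ≈-trans (⊛≈· a (pow a n)) (·-cong ≈-refl (pow≈^ a n))

one-^ : ∀ n → one ^ n ≈ one
one-^ zero    = ≈-refl
one-^ (suc n) = ≈-trans (·-identityˡ (one ^ n)) (one-^ n)

-- Agreement up to a given degree

infix 4 _≈[_]_

record _≈[_]_ (a : Series) (N : ℕ) (b : Series) : Set where
  constructor coeffs≤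
  field coeff≤ : ∀ n → n ≤ N → a n ≡ b n

open _≈[_]_

≈⇒≈[] : ∀ {N} → a ≈ b → a ≈[ N ] b
≈⇒≈[] p = coeffs≤ λ n _ → coeff p n

≈[]⇒≈ : (∀ N → a ≈[ N ] b) → a ≈ b
≈[]⇒≈ p = coeffs λ n → coeff≤ (p n) n ℕ.≤-refl

≈[]-setoid : ℕ → Setoid 0ℓ 0ℓ
≈[]-setoid N = record
  { Carrier = Series ; _≈_ = _≈[ N ]_
  ; isEquivalence = record
    { refl  = coeffs≤ λ _ _ → refl
    ; sym   = λ p → coeffs≤ λ n n≤N → sym (coeff≤ p n n≤N)
    ; trans = λ p r → coeffs≤ λ n n≤N → trans (coeff≤ p n n≤N) (coeff≤ r n n≤N) } }

module _ {N : ℕ} where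
  open Setoid (≈[]-setoid N) public
    using () renaming (refl to ≈[]-refl; sym to ≈[]-sym; trans to ≈[]-trans)

module ≈[]-Reasoning (N : ℕ) = SetoidReasoning (≈[]-setoid N)

opaque
  unfolding _·_

  ·-cong≤ : ∀ {N} → a ≈[ N ] b → c ≈[ N ] d → a · c ≈[ N ] b · d
  ·-cong≤ p r = coeffs≤ λ n n≤N → sumTo-cong≤ n λ i i≤n →
    cong₂ _*ᶻ_ (coeff≤ p i (ℕ.≤-trans i≤n n≤N)) (coeff≤ r (n ∸ i) (ℕ.≤-trans (ℕ.m∸n≤m n i) n≤N))

⊕-cong≤ : ∀ {N} → a ≈[ N ] b → c ≈[ N ] d → a ⊕ c ≈[ N ] b ⊕ d
⊕-cong≤ p r = coeffs≤ λ n n≤N → cong₂ _+ᶻ_ (coeff≤ p n n≤N) (coeff≤ r n n≤N)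

⊖-cong≤ : ∀ {N} → a ≈[ N ] b → c ≈[ N ] d → a ⊖ c ≈[ N ] b ⊖ d
⊖-cong≤ p r = coeffs≤ λ n n≤N → cong₂ _-ᶻ_ (coeff≤ p n n≤N) (coeff≤ r n n≤N)

-- `f`, `inv` and `theta` all read coefficient n off the n-th approximation. Under this condition
-- the diagonal agrees with every later approximation as well.
Stable : (ℕ → Series) → Set
Stable s = ∀ m → s (suc m) ≈[ m ] s m

lim : (ℕ → Series) → Series
lim s n = s n n

lim≈[] : ∀ {s} → Stable s → ∀ {N m} → N ≤ m → lim s ≈[ N ] s m
lim≈[] {s} stable {N} {m} N≤m = coeffs≤ λ n n≤N → go (ℕ.≤⇒≤′ (ℕ.≤-trans n≤N N≤m))
  where
  go : ∀ {n m} → n ℕ.≤′ m → s n n ≡ s m n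
  go (ℕ.≤′-reflexive refl) = refl
  go (ℕ.≤′-step n≤′m)      = trans (go n≤′m) (sym (coeff≤ (stable _) _ (ℕ.≤′⇒≤ n≤′m)))

mono≡0 : ∀ {d n} → n < d → mono d n ≡ + 0
mono≡0 {suc d} {zero}  _         = refl
mono≡0 {suc d} {suc n} (s≤s n<d) = mono≡0 n<d

mono≈[]0 : ∀ {N d} → N < d → mono d ≈[ N ] zeroS
mono≈[]0 N<d = coeffs≤ λ n n≤N → mono≡0 (ℕ.≤-<-trans n≤N N<d)

·-mono≈[]0 : ∀ a {N d} → N < d → a · mono d ≈[ N ] zeroS
·-mono≈[]0 a N<d = ≈[]-trans (·-cong≤ (≈[]-refl {x = a}) (mono≈[]0 N<d))
  (≈⇒≈[] (·-zeroʳ a))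

0*x+y≡y : ∀ x y → + 0 *ᶻ x +ᶻ y ≡ y
0*x+y≡y x y = trans (cong (_+ᶻ y) (ℤ.*-zeroˡ x)) (ℤ.+-identityˡ y)

mono-suc-· : ∀ d a n → (mono (suc d) · a) (suc n) ≡ (mono d · a) n
mono-suc-· d a n = trans (·-suc (mono (suc d)) a n) (0*x+y≡y (a (suc n)) _)

mono-+ : ∀ d e → mono d · mono e ≈ mono (d + e)
mono-+ d e = coeffs (go d)
  where
  go : ∀ d n → (mono d · mono e) n ≡ mono (d + e) n
  go zero    n       = coeff (·-identityˡ (mono e)) n
  go (suc d) zero    = ·-zero (mono (suc d)) (mono e)
  go (suc d) (suc n) = trans (mono-suc-· d (mono e) n) (go d n)

-- Inverses

geometric : Series → ℕ → Series
geometric g N n = sumTo N (λ m → pow g m n)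

·-order : ∀ {N} → a 0 ≡ + 0 → b ≈[ N ] zeroS → a · b ≈[ suc N ] zeroS
·-order {a} {b} {N} a₀ p = coeffs≤ go
  where
  go : ∀ n → n ≤ suc N → (a · b) n ≡ + 0
  go zero    _         = trans (·-zero a b) (cong (_*ᶻ b 0) a₀)
  go (suc n) (s≤s n≤N) = trans (·-suc a b n)
    (trans (cong (λ t → t *ᶻ b (suc n) +ᶻ (tail a · b) n) a₀)
    (trans (0*x+y≡y (b (suc n)) _)
    (trans (coeff≤ (·-cong≤ (≈[]-refl {x = tail a}) p) n n≤N)
           (coeff (·-zeroʳ (tail a)) n))))

pow-order : ∀ a → a 0 ≡ + 0 → ∀ N → pow a (suc N) ≈[ N ] zeroS
pow-order a a₀ N = ≈[]-trans (≈⇒≈[] (pow≈^ a (suc N))) (go N)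
  where
  go : ∀ N → a ^ suc N ≈[ N ] zeroS
  go zero    = coeffs≤ λ { zero _ → trans (·-zero a one) (cong (_*ᶻ + 1) a₀) }
  go (suc N) = ·-order a₀ (go N)

geometric-stable : a 0 ≡ + 0 → Stable (geometric a)
geometric-stable {a} a₀ m = coeffs≤ λ n n≤m →
  trans (cong (geometric a m n +ᶻ_) (coeff≤ (pow-order a a₀ m) n n≤m)) (ℤ.+-identityʳ _)

geometric-sum : ∀ g N → (one ⊖ g) · geometric g N ≈ one ⊖ pow g (suc N)
geometric-sum g zero = begin
  (one ⊖ g) · one   ≈⟨ ·-identityʳ (one ⊖ g) ⟩
  one ⊖ g           ≈⟨ ⊖-cong {one} ≈-refl (·-identityʳ g) ⟨
  one ⊖ (g · one)   ≈⟨ ⊖-cong {one} ≈-refl (⊛≈· g one) ⟨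
  one ⊖ (g ⊛ one)   ∎
geometric-sum g (suc N) = begin
  (one ⊖ g) · (geometric g N ⊕ gᴺ)          ≈⟨ ·-distribˡ (one ⊖ g) (geometric g N) gᴺ ⟩
  (one ⊖ g) · geometric g N ⊕ (one ⊖ g) · gᴺ ≈⟨ ⊕-cong (geometric-sum g N) ≈-refl ⟩
  (one ⊖ gᴺ) ⊕ (one ⊖ g) · gᴺ               ≈⟨ ⊕-cong (⊖-cong (≈-sym const-1) ≈-refl)
                                                 (·-cong (⊖-cong (≈-sym const-1) ≈-refl) ≈-refl) ⟩
  (const (+ 1) ⊖ gᴺ) ⊕ (const (+ 1) ⊖ g) · gᴺ
    ≈⟨ solve 2 (λ g h → (con (+ 1) :- h) :+ (con (+ 1) :- g) :* h := con (+ 1) :- g :* h) ≈-refl g gᴺ ⟩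
  const (+ 1) ⊖ g · gᴺ                      ≈⟨ ⊖-cong const-1 (≈-sym (⊛≈· g gᴺ)) ⟩
  one ⊖ (g ⊛ gᴺ)                            ∎
  where gᴺ = pow g (suc N)

inv-inverse : a 0 ≡ + 1 → a · inv a ≈ one
inv-inverse {a} a₀ = ≈[]⇒≈ λ N → let module ≤N = ≈[]-Reasoning N in ≤N.begin
  a · inv a
    ≤N.≈⟨ ·-cong≤ (≈⇒≈[] {a} {one ⊖ g} (solve 2 (λ a b → a := b :- (b :- a)) ≈-refl a one))
               (lim≈[] (geometric-stable g₀) ℕ.≤-refl) ⟩
  (one ⊖ g) · geometric g N   ≤N.≈⟨ ≈⇒≈[] (geometric-sum g N) ⟩
  one ⊖ pow g (suc N)         ≤N.≈⟨ ⊖-cong≤ (≈[]-refl {x = one}) (pow-order g g₀ N) ⟩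
  one ⊖ zeroS                 ≤N.≈⟨ ≈⇒≈[] (coeffs λ n → ℤ.+-identityʳ (one n)) ⟩
  one                         ≤N.∎
  where
  g = one ⊖ a
  g₀ : g 0 ≡ + 0
  g₀ = cong (λ t → + 1 +ᶻ -ᶻ t) a₀

·-cancelˡ : a 0 ≡ + 1 → a · b ≈ a · c → b ≈ c
·-cancelˡ {a} {b} {c} a₀ p = begin
  b                ≈⟨ expand b ⟨
  inv a · (a · b)  ≈⟨ ·-cong ≈-refl p ⟩
  inv a · (a · c)  ≈⟨ expand c ⟩
  c                ∎
  where
  expand : ∀ x → inv a · (a · x) ≈ x
  expand x = begin
    inv a · (a · x)  ≈⟨ ·-assoc (inv a) a x ⟨
    (inv a · a) · x  ≈⟨ ·-cong (≈-trans (·-comm (inv a) a) (inv-inverse a₀)) ≈-refl ⟩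
    one · x          ≈⟨ ·-identityˡ x ⟩
    x                ∎

^-zero : a 0 ≡ + 1 → ∀ n → (a ^ n) 0 ≡ + 1
^-zero {a} a₀ zero    = refl
^-zero {a} a₀ (suc n) = trans (·-zero a (a ^ n)) (cong₂ _*ᶻ_ a₀ (^-zero a₀ n))

inv-pow : a 0 ≡ + 1 → ∀ n → inv (pow a n) ≈ inv a ^ n
inv-pow {a} a₀ n = ·-cancelˡ aⁿ₀ (begin
  pow a n · inv (pow a n)  ≈⟨ inv-inverse aⁿ₀ ⟩
  one                      ≈⟨ one-^ n ⟨
  one ^ n                  ≈⟨ ^-congˡ n (inv-inverse a₀) ⟨
  (a · inv a) ^ n          ≈⟨ ^-distrib-* a (inv a) n ⟩
  a ^ n · inv a ^ n        ≈⟨ ·-cong (pow≈^ a n) ≈-refl ⟨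
  pow a n · inv a ^ n      ∎)
  where
  aⁿ₀ : pow a n 0 ≡ + 1
  aⁿ₀ = trans (coeff (pow≈^ a n) 0) (^-zero a₀ n)

-- The substitutions q ↦ -q and q ↦ q²

sgn : Series → Series
sgn a zero    = a 0
sgn a (suc n) = -ᶻ sgn (tail a) n

dil : Series → Series
dil a zero          = a 0
dil a (suc zero)    = + 0
dil a (suc (suc n)) = dil (tail a) n

dil-cong≤ : ∀ {N} → a ≈[ N ] b → dil a ≈[ N ] dil b
dil-cong≤ p = coeffs≤ λ n n≤N → go n (λ m m≤n → coeff≤ p m (ℕ.≤-trans m≤n n≤N))
  where
  go : ∀ n {a b : Series} → (∀ m → m ≤ n → a m ≡ b m) → dil a n ≡ dil b n
  go zero          p = p 0 z≤n
  go (suc zero)    p = refl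
  go (suc (suc n)) p = go n (λ m m≤n → p (suc m) (s≤s (ℕ.m≤n⇒m≤1+n m≤n)))

dil-cong : a ≈ b → dil a ≈ dil b
dil-cong p = ≈[]⇒≈ λ N → dil-cong≤ (≈⇒≈[] p)

sgn-cong≤ : ∀ {N} → a ≈[ N ] b → sgn a ≈[ N ] sgn b
sgn-cong≤ p = coeffs≤ λ n n≤N → go n (λ m m≤n → coeff≤ p m (ℕ.≤-trans m≤n n≤N))
  where
  go : ∀ n {a b : Series} → (∀ m → m ≤ n → a m ≡ b m) → sgn a n ≡ sgn b n
  go zero    p = p 0 z≤n
  go (suc n) p = cong -ᶻ_ (go n (λ m m≤n → p (suc m) (s≤s m≤n)))

sgn-cong : a ≈ b → sgn a ≈ sgn b
sgn-cong p = ≈[]⇒≈ λ N → sgn-cong≤ (≈⇒≈[] p)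

sgn-⊕ : ∀ a b → sgn (a ⊕ b) ≈ sgn a ⊕ sgn b
sgn-⊕ a b = coeffs (go a b)
  where
  go : ∀ a b n → sgn (a ⊕ b) n ≡ sgn a n +ᶻ sgn b n
  go a b zero    = refl
  go a b (suc n) = trans (cong -ᶻ_ (go (tail a) (tail b) n)) (ℤ.neg-distrib-+ (sgn (tail a) n) (sgn (tail b) n))

sgn-neg : ∀ a → sgn (neg a) ≈ neg (sgn a)
sgn-neg a = coeffs (go a)
  where
  go : ∀ a n → sgn (neg a) n ≡ -ᶻ sgn a n
  go a zero    = refl
  go a (suc n) = cong -ᶻ_ (go (tail a) n)

sgn-scale : ∀ k a → sgn (scale k a) ≈ scale k (sgn a)
sgn-scale k a = coeffs (go a)
  where
  go : ∀ a n → sgn (scale k a) n ≡ k *ᶻ sgn a n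
  go a zero    = refl
  go a (suc n) = trans (cong -ᶻ_ (go (tail a) n)) (ℤ.neg-distribʳ-* k _)

neg-· : ∀ a b → neg a · b ≈ neg (a · b)
neg-· = solve 2 (λ a b → (:- a) :* b := :- (a :* b)) ≈-refl

sgn-· : ∀ a b → sgn (a · b) ≈ sgn a · sgn b
sgn-· a b = coeffs λ n → go n a b
  where
  go : ∀ n a b → sgn (a · b) n ≡ (sgn a · sgn b) n
  go zero    a b = trans (·-zero a b) (sym (·-zero (sgn a) (sgn b)))
  go (suc n) a b = ≡.begin
    -ᶻ sgn (tail (a · b)) n
      ≡.≡⟨ cong -ᶻ_ (coeff (sgn-cong (coeffs (·-suc a b))) n) ⟩
    -ᶻ sgn (scale (a 0) (tail b) ⊕ (tail a · b)) n
      ≡.≡⟨ cong -ᶻ_ (coeff (sgn-⊕ (scale (a 0) (tail b)) (tail a · b)) n) ⟩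
    -ᶻ (sgn (scale (a 0) (tail b)) n +ᶻ sgn (tail a · b) n)
      ≡.≡⟨ cong -ᶻ_ (cong₂ _+ᶻ_ (coeff (sgn-scale (a 0) (tail b)) n) (go n (tail a) b)) ⟩
    -ᶻ (a 0 *ᶻ sgn (tail b) n +ᶻ (sgn (tail a) · sgn b) n)
      ≡.≡⟨ ℤ.neg-distrib-+ (a 0 *ᶻ sgn (tail b) n) _ ⟩
    -ᶻ (a 0 *ᶻ sgn (tail b) n) +ᶻ -ᶻ (sgn (tail a) · sgn b) n
      ≡.≡⟨ cong₂ _+ᶻ_ (ℤ.neg-distribʳ-* (a 0) _) (sym (coeff (neg-· (sgn (tail a)) (sgn b)) n)) ⟩
    a 0 *ᶻ sgn b (suc n) +ᶻ (tail (sgn a) · sgn b) n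
      ≡.≡⟨ ·-suc (sgn a) (sgn b) n ⟨
    (sgn a · sgn b) (suc n) ≡.∎

sgn-one : sgn one ≈ one
sgn-one = coeffs λ { zero → refl ; (suc n) → go n }
  where
  go : ∀ n → -ᶻ sgn (tail one) n ≡ + 0
  go zero    = refl
  go (suc n) = cong -ᶻ_ (go n)

sgn-^ : ∀ a n → sgn (a ^ n) ≈ sgn a ^ n
sgn-^ a zero    = sgn-one
sgn-^ a (suc n) = ≈-trans (sgn-· a (a ^ n)) (·-cong ≈-refl (sgn-^ a n))

dil-⊕ : ∀ a b → dil (a ⊕ b) ≈ dil a ⊕ dil b
dil-⊕ a b = coeffs λ n → go n a b
  where
  go : ∀ n a b → dil (a ⊕ b) n ≡ dil a n +ᶻ dil b n
  go zero          a b = refl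
  go (suc zero)    a b = refl
  go (suc (suc n)) a b = go n (tail a) (tail b)

dil-neg : ∀ a → dil (neg a) ≈ neg (dil a)
dil-neg a = coeffs λ n → go n a
  where
  go : ∀ n a → dil (neg a) n ≡ -ᶻ dil a n
  go zero          a = refl
  go (suc zero)    a = refl
  go (suc (suc n)) a = go n (tail a)

dil-⊖ : ∀ a b → dil (a ⊖ b) ≈ dil a ⊖ dil b
dil-⊖ a b = ≈-trans (dil-⊕ a (neg b)) (⊕-cong {dil a} ≈-refl (dil-neg b))

dil-scale : ∀ k a → dil (scale k a) ≈ scale k (dil a)
dil-scale k a = coeffs λ n → go n a
  where
  go : ∀ n a → dil (scale k a) n ≡ k *ᶻ dil a n
  go zero          a = refl
  go (suc zero)    a = sym (ℤ.*-zeroʳ k)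
  go (suc (suc n)) a = go n (tail a)

dil-· : ∀ a b → dil (a · b) ≈ dil a · dil b
dil-· a b = coeffs λ n → go n a b
  where
  go : ∀ n a b → dil (a · b) n ≡ (dil a · dil b) n
  go zero       a b = trans (·-zero a b) (sym (·-zero (dil a) (dil b)))
  go (suc zero) a b = sym (≡.begin
    (dil a · dil b) 1                              ≡.≡⟨ ·-suc (dil a) (dil b) 0 ⟩
    a 0 *ᶻ + 0 +ᶻ (tail (dil a) · dil b) 0         ≡.≡⟨ cong₂ _+ᶻ_ (ℤ.*-zeroʳ (a 0)) (·-zero (tail (dil a)) (dil b)) ⟩
    + 0                                            ≡.∎)
  go (suc (suc n)) a b = ≡.begin
    dil (tail (a · b)) n
      ≡.≡⟨ coeff (dil-cong (coeffs (·-suc a b))) n ⟩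
    dil (scale (a 0) (tail b) ⊕ (tail a · b)) n
      ≡.≡⟨ coeff (dil-⊕ (scale (a 0) (tail b)) (tail a · b)) n ⟩
    dil (scale (a 0) (tail b)) n +ᶻ dil (tail a · b) n
      ≡.≡⟨ cong₂ _+ᶻ_ (coeff (dil-scale (a 0) (tail b)) n) (go n (tail a) b) ⟩
    a 0 *ᶻ dil b (2 + n) +ᶻ (dil (tail a) · dil b) n
      -- The added `+ 0` is the coefficient of q in `dil a`, that is, the constant term of
      -- `tail (dil a)`; with it in place `·-suc` can be read backwards twice.
      ≡.≡⟨ cong (a 0 *ᶻ dil b (2 + n) +ᶻ_) (0*x+y≡y (dil b (suc n)) _) ⟨
    a 0 *ᶻ dil b (2 + n) +ᶻ (+ 0 *ᶻ dil b (suc n) +ᶻ (dil (tail a) · dil b) n)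
      ≡.≡⟨ cong (a 0 *ᶻ dil b (2 + n) +ᶻ_) (·-suc (tail (dil a)) (dil b) n) ⟨
    a 0 *ᶻ dil b (2 + n) +ᶻ (tail (dil a) · dil b) (suc n)
      ≡.≡⟨ ·-suc (dil a) (dil b) (suc n) ⟨
    (dil a · dil b) (2 + n) ≡.∎

dil-0 : ∀ n → dil zeroS n ≡ + 0
dil-0 zero          = refl
dil-0 (suc zero)    = refl
dil-0 (suc (suc n)) = dil-0 n

dil-mono : ∀ d → dil (mono d) ≈ mono (d + d)
dil-mono d = coeffs (go d)
  where
  go : ∀ d n → dil (mono d) n ≡ mono (d + d) n
  go zero    zero          = refl
  go zero    (suc zero)    = refl
  go zero    (suc (suc n)) = dil-0 n
  go (suc d) zero          = refl
  go (suc d) (suc zero)    = cong (λ e → mono e 0) (sym (ℕ.+-suc d d))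
  go (suc d) (suc (suc n)) = trans (go d n) (cong (λ e → mono e (suc n)) (sym (ℕ.+-suc d d)))

dil-const : ∀ k → dil (const k) ≈ const k
dil-const k = coeffs λ { zero → refl ; (suc zero) → refl ; (suc (suc n)) → dil-0 n }

dil-^ : ∀ a n → dil (a ^ n) ≈ dil a ^ n
dil-^ a zero    = dil-mono 0
dil-^ a (suc n) = ≈-trans (dil-· a (a ^ n)) (·-cong ≈-refl (dil-^ a n))

sgn-dil : ∀ a → sgn (dil a) ≈ dil a
sgn-dil a = coeffs λ n → go n a
  where
  go : ∀ n a → sgn (dil a) n ≡ dil a n
  go zero          a = refl
  go (suc zero)    a = refl
  go (suc (suc n)) a = trans (ℤ.neg-involutive _) (go n (tail a))

dil-double : ∀ a n → dil a (n + n) ≡ a n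
dil-double a zero    = refl
dil-double a (suc n) = trans (cong (λ m → dil a (suc m)) (ℕ.+-suc n n)) (dil-double (tail a) n)

-- Products

∏ : (ℕ → Series) → ℕ → Series
∏ g zero    = one
∏ g (suc n) = ∏ g n · g n

∏-cong : ∀ {g h} → (∀ j → g j ≈ h j) → ∀ n → ∏ g n ≈ ∏ h n
∏-cong p zero    = ≈-refl
∏-cong p (suc n) = ·-cong (∏-cong p n) (p n)

∏-distrib-· : ∀ g h n → ∏ (λ j → g j · h j) n ≈ ∏ g n · ∏ h n
∏-distrib-· g h zero    = ≈-sym (·-identityˡ one)
∏-distrib-· g h (suc n) = begin
  ∏ (λ j → g j · h j) n · (g n · h n)  ≈⟨ ·-cong (∏-distrib-· g h n) ≈-refl ⟩
  ∏ g n · ∏ h n · (g n · h n)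
    ≈⟨ solve 4 (λ p r x y → p :* r :* (x :* y) := p :* x :* (r :* y)) ≈-refl (∏ g n) (∏ h n) (g n) (h n) ⟩
  ∏ g n · g n · (∏ h n · h n)          ∎

∏-shift : ∀ g n → ∏ g (suc n) ≈ g 0 · ∏ (λ j → g (suc j)) n
∏-shift g zero    = ·-comm one (g 0)
∏-shift g (suc n) = ≈-trans (·-cong (∏-shift g n) ≈-refl) (·-assoc (g 0) _ (g (suc n)))

∏-double : ∀ g n → ∏ g (n + n) ≈ ∏ (λ j → g (j + j)) n · ∏ (λ j → g (suc (j + j))) n
∏-double g zero    = ≈-sym (·-identityˡ one)
∏-double g (suc n) = begin
  ∏ g (suc n + suc n)                    ≈⟨ ≡⇒≈ (cong (λ m → ∏ g (suc m)) (ℕ.+-suc n n)) ⟩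
  ∏ g (n + n) · g (n + n) · g (suc (n + n)) ≈⟨ ·-cong (·-cong (∏-double g n) ≈-refl) ≈-refl ⟩
  evens · odds · g (n + n) · g (suc (n + n))
    ≈⟨ solve 4 (λ p r x y → p :* r :* x :* y := p :* x :* (r :* y)) ≈-refl evens odds (g (n + n)) (g (suc (n + n))) ⟩
  evens · g (n + n) · (odds · g (suc (n + n))) ∎
  where
  evens = ∏ (λ j → g (j + j)) n
  odds  = ∏ (λ j → g (suc (j + j))) n

sgn-∏ : ∀ g n → sgn (∏ g n) ≈ ∏ (λ j → sgn (g j)) n
sgn-∏ g zero    = sgn-one
sgn-∏ g (suc n) = ≈-trans (sgn-· (∏ g n) (g n)) (·-cong (sgn-∏ g n) ≈-refl)

dil-∏ : ∀ g n → dil (∏ g n) ≈ ∏ (λ j → dil (g j)) n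
dil-∏ g zero    = dil-mono 0
dil-∏ g (suc n) = ≈-trans (dil-· (∏ g n) (g n)) (·-cong (dil-∏ g n) ≈-refl)

mono-cong : ∀ {d e} → d ≡ e → mono d ≈ mono e
mono-cong refl = ≈-refl

one⊖mono-cong : ∀ {d e} → d ≡ e → one ⊖ mono d ≈ one ⊖ mono e
one⊖mono-cong refl = ≈-refl

one⊖-· : ∀ x → (one ⊖ x) · (one ⊕ x) ≈ one ⊖ x · x
one⊖-· = solve 1 (λ x → (:1 :- x) :* (:1 :+ x) := :1 :- x :* x) ≈-refl

dil-one⊖mono : ∀ d → dil (one ⊖ mono d) ≈ one ⊖ mono (d + d)
dil-one⊖mono d = ≈-trans (dil-⊖ one (mono d)) (⊖-cong (dil-mono 0) (dil-mono d))

-- Euler products under q ↦ -q and q ↦ q²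

eulerProd : ℕ → ℕ → Series
eulerProd k = ∏ (λ j → one ⊖ mono (k * suc j))

prodTrunc≈eulerProd : ∀ k m → prodTrunc k m ≈ eulerProd k m
prodTrunc≈eulerProd k zero    = ≈-refl
prodTrunc≈eulerProd k (suc m) =
  ≈-trans (⊛≈· (prodTrunc k m) (one ⊖ mono (k * suc m))) (·-cong (prodTrunc≈eulerProd k m) ≈-refl)

-- The next factor differs from 1 only in degree (k + 1)(m + 1) > m. For index 0 the claim fails:
-- the factors would be 1 - q⁰ = 0.
prodTrunc-stable : ∀ k → Stable (prodTrunc (suc k))
prodTrunc-stable k m = ≤m.begin
  prodTrunc (suc k) (suc m)           ≤m.≈⟨ ≈⇒≈[] (⊛≈· P (one ⊖ mono (suc k * suc m))) ⟩
  P · (one ⊖ mono (suc k * suc m))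
    ≤m.≈⟨ ·-cong≤ (≈[]-refl {x = P}) (⊖-cong≤ (≈[]-refl {x = one}) (mono≈[]0 (ℕ.m≤m+n (suc m) (k * suc m)))) ⟩
  P · (one ⊖ zeroS)                   ≤m.≈⟨ ≈⇒≈[] (·-cong ≈-refl (coeffs λ n → ℤ.+-identityʳ (one n))) ⟩
  P · one                             ≤m.≈⟨ ≈⇒≈[] (·-identityʳ P) ⟩
  P                                   ≤m.∎
  where
  P = prodTrunc (suc k) m
  module ≤m = ≈[]-Reasoning m

f≈[]eulerProd : ∀ k {N m} → N ≤ m → f (suc k) ≈[ N ] eulerProd (suc k) m
f≈[]eulerProd k {N} {m} N≤m =
  ≈[]-trans (lim≈[] {prodTrunc (suc k)} (prodTrunc-stable k) N≤m) (≈⇒≈[] (prodTrunc≈eulerProd (suc k) m))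

double : ∀ n → 2 * n ≡ n + n
double n = cong (λ m → n + m) (ℕ.+-identityʳ n)

dil-eulerProd : ∀ n → dil (eulerProd 1 n) ≈ eulerProd 2 n
dil-eulerProd n = ≈-trans (dil-∏ _ n) (∏-cong (λ j → ≈-trans (dil-one⊖mono (1 * suc j)) (one⊖mono-cong (eq j))) n)
  where
  eq : ∀ j → 1 * suc j + 1 * suc j ≡ 2 * suc j
  eq j = trans (cong₂ _+_ (ℕ.*-identityˡ (suc j)) (ℕ.*-identityˡ (suc j))) (sym (double (suc j)))

f₂≈dil-f₁ : f 2 ≈ dil (f 1)
f₂≈dil-f₁ = ≈[]⇒≈ λ N → ≈[]-trans (f≈[]eulerProd 1 ℕ.≤-refl)
  (≈[]-trans (≈⇒≈[] (≈-sym (dil-eulerProd N))) (dil-cong≤ (≈[]-sym (f≈[]eulerProd 0 ℕ.≤-refl))))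

oddProd : ℕ → Series
oddProd = ∏ (λ j → one ⊖ mono (suc (j + j)))

-- The factor of index j has exponent j + 1, so the even indices give the odd exponents.
eulerProd-split : ∀ n → eulerProd 1 (n + n) ≈ oddProd n · eulerProd 2 n
eulerProd-split n = ≈-trans (∏-double _ n)
  (·-cong (∏-cong (λ j → one⊖mono-cong (ℕ.*-identityˡ (suc (j + j)))) n)
          (∏-cong (λ j → one⊖mono-cong (eq j)) n))
  where
  eq : ∀ j → 1 * suc (suc (j + j)) ≡ 2 * suc j
  eq j = trans (ℕ.*-identityˡ _) (trans (cong suc (sym (ℕ.+-suc j j))) (sym (double (suc j))))

-- An even power of q is a dilation, hence fixed by `sgn`; the one remaining q changes the sign.
sgn-mono-odd : ∀ d → sgn (mono (suc (d + d))) ≈ neg (mono (suc (d + d)))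
sgn-mono-odd d = coeffs λ { zero → refl ; (suc n) → cong -ᶻ_ (coeff even n) }
  where
  even : sgn (mono (d + d)) ≈ mono (d + d)
  even = ≈-trans (sgn-cong (≈-sym (dil-mono d))) (≈-trans (sgn-dil (mono d)) (dil-mono d))

oddProd-sgn : ∀ n → oddProd n · sgn (oddProd n) ≈ dil (oddProd n)
oddProd-sgn n = begin
  oddProd n · sgn (oddProd n)       ≈⟨ ·-cong ≈-refl (sgn-∏ _ n) ⟩
  oddProd n · ∏ (λ j → sgn (u j)) n ≈⟨ ∏-distrib-· u _ n ⟨
  ∏ (λ j → u j · sgn (u j)) n       ≈⟨ ∏-cong factor n ⟩
  ∏ (λ j → dil (u j)) n             ≈⟨ dil-∏ _ n ⟨
  dil (oddProd n)                   ∎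
  where
  u : ℕ → Series
  u j = one ⊖ mono (suc (j + j))
  factor : ∀ j → u j · sgn (u j) ≈ dil (u j)
  factor j = begin
    u j · sgn (u j)               ≈⟨ ·-cong ≈-refl (sgn-⊕ one (neg x)) ⟩
    u j · (sgn one ⊕ sgn (neg x)) ≈⟨ ·-cong ≈-refl (⊕-cong sgn-one (≈-trans (sgn-neg x) (neg-cong (sgn-mono-odd j)))) ⟩
    u j · (one ⊕ neg (neg x))     ≈⟨ solve 2 (λ v x → v :* (:1 :+ (:- (:- x))) := v :* (:1 :+ x)) ≈-refl (u j) x ⟩
    u j · (one ⊕ x)               ≈⟨ one⊖-· x ⟩
    one ⊖ x · x                   ≈⟨ ⊖-cong {one} ≈-refl (mono-+ (suc (j + j)) (suc (j + j))) ⟩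
    one ⊖ mono (suc (j + j) + suc (j + j)) ≈⟨ dil-one⊖mono (suc (j + j)) ⟨
    dil (u j)                     ∎
    where x = mono (suc (j + j))

-- Write f₁ = O f₂ with O the product over odd exponents. As f₂ is even, f₁(-q) = O(-q) f₂, and O(q)
-- O(-q) = O(q²). Finally O(q²) f₄ is f₁ at q², which is f₂.
f-sgn : f 1 · sgn (f 1) · dil (f 2) ≈ f 2 ^ 3
f-sgn = ≈[]⇒≈ λ N → let
    module ≤N = ≈[]-Reasoning N
    P = eulerProd 1 (N + N)
    R = eulerProd 2 N
    O = oddProd N
    sgn-R : sgn R ≈ R
    sgn-R = ≈-trans (sgn-cong (≈-sym (dil-eulerProd N))) (≈-trans (sgn-dil _) (dil-eulerProd N))
    N≤2N = ℕ.m≤m+n N N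
  in ≤N.begin
  f 1 · sgn (f 1) · dil (f 2)
    ≤N.≈⟨ ·-cong≤ (·-cong≤ (f≈[]eulerProd 0 N≤2N) (sgn-cong≤ (f≈[]eulerProd 0 N≤2N)))
                  (dil-cong≤ (f≈[]eulerProd 1 ℕ.≤-refl)) ⟩
  P · sgn P · dil R
    ≤N.≈⟨ ≈⇒≈[] (·-cong (·-cong (eulerProd-split N) (≈-trans (sgn-cong (eulerProd-split N))
                          (≈-trans (sgn-· O R) (·-cong ≈-refl sgn-R)))) ≈-refl) ⟩
  (O · R) · (sgn O · R) · dil R
    ≤N.≈⟨ ≈⇒≈[] (solve 4 (λ o r s t → (o :* r) :* (s :* r) :* t := (o :* s) :* t :* (r :* r)) ≈-refl O R (sgn O) (dil R)) ⟩
  O · sgn O · dil R · (R · R)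
    ≤N.≈⟨ ≈⇒≈[] (·-cong (·-cong (oddProd-sgn N) ≈-refl) ≈-refl) ⟩
  dil O · dil R · (R · R)
    ≤N.≈⟨ ≈⇒≈[] (·-cong (≈-trans (≈-sym (dil-· O R)) (≈-trans (dil-cong (≈-sym (eulerProd-split N))) (dil-eulerProd (N + N)))) ≈-refl) ⟩
  eulerProd 2 (N + N) · (R · R)
    ≤N.≈⟨ ·-cong≤ (f≈[]eulerProd 1 N≤2N) (·-cong≤ (f≈[]eulerProd 1 ℕ.≤-refl) (f≈[]eulerProd 1 ℕ.≤-refl)) ⟨
  f 2 · (f 2 · f 2)
    ≤N.≈⟨ ≈⇒≈[] (solve 1 (λ x → x :* (x :* x) := x :^ 3) ≈-refl (f 2)) ⟩
  f 2 ^ 3 ≤N.∎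

-- Gauss's theta series

sign : ℕ → ℤ
sign zero    = + 1
sign (suc n) = -ᶻ sign n

sign-+ : ∀ m n → sign (m + n) ≡ sign m *ᶻ sign n
sign-+ zero    n = sym (ℤ.*-identityˡ (sign n))
sign-+ (suc m) n = trans (cong -ᶻ_ (sign-+ m n)) (ℤ.neg-distribˡ-* (sign m) (sign n))

sign-double : ∀ n → sign (n + n) ≡ + 1
sign-double zero    = refl
sign-double (suc n) = trans (cong (λ m → -ᶻ sign m) (ℕ.+-suc n n)) (trans (ℤ.neg-involutive _) (sign-double n))

sign-square : ∀ n → sign (n * n) ≡ sign n
sign-square zero    = refl
sign-square (suc n) = cong -ᶻ_ (≡.begin
  sign (n + n * suc n)               ≡.≡⟨ cong (λ m → sign (n + m)) (ℕ.*-suc n n) ⟩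
  sign (n + (n + n * n))             ≡.≡⟨ cong sign (ℕ.+-assoc n n (n * n)) ⟨
  sign (n + n + n * n)               ≡.≡⟨ sign-+ (n + n) (n * n) ⟩
  sign (n + n) *ᶻ sign (n * n)       ≡.≡⟨ cong₂ _*ᶻ_ (sign-double n) (sign-square n) ⟩
  + 1 *ᶻ sign n                      ≡.≡⟨ ℤ.*-identityˡ (sign n) ⟩
  sign n                             ≡.∎)

sgn-mono : ∀ d → sgn (mono d) ≈ const (sign d) · mono d
sgn-mono d = ≈-trans (coeffs (go d)) (≈-sym (const-· (sign d) (mono d)))
  where
  go : ∀ d n → sgn (mono d) n ≡ sign d *ᶻ mono d n
  go zero    n       = trans (coeff sgn-one n) (sym (ℤ.*-identityˡ (one n)))
  go (suc d) zero    = sym (ℤ.*-zeroʳ (sign (suc d)))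
  go (suc d) (suc n) = trans (cong -ᶻ_ (go d n)) (ℤ.neg-distribˡ-* (sign d) (mono d n))

-- The partial sums of Σ_{j ∈ ℤ} ε_j q^{j²} for even ε with ε₀ = 1.
thetaSum : (ℕ → ℤ) → ℕ → Series
thetaSum ε zero    = one
thetaSum ε (suc n) = thetaSum ε n ⊕ const (+ 2 *ᶻ ε (suc n)) · mono (suc n * suc n)

thetaSum-stable : ∀ ε → Stable (thetaSum ε)
thetaSum-stable ε m = ≈[]-trans
  (⊕-cong≤ (≈[]-refl {x = thetaSum ε m})
           (·-mono≈[]0 (const (+ 2 *ᶻ ε (suc m))) (ℕ.m≤m*n (suc m) (suc m))))
  (≈⇒≈[] (coeffs λ n → ℤ.+-identityʳ (thetaSum ε m n)))

theta : (ℕ → ℤ) → Series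
theta ε = lim (thetaSum ε)


-- Shanks' finite form of Gauss's identity

tailProd : ℕ → ℕ → Series
tailProd n j = ∏ (λ i → one ⊖ mono (suc (j + i))) (n ∸ j)

tailProd-suc : ∀ {m j} → j ≤ m → tailProd (suc m) j ≈ tailProd m j · (one ⊖ mono (suc m))
tailProd-suc {m} {j} j≤m = ≈-trans (≡⇒≈ (cong (∏ _) (ℕ.+-∸-assoc 1 j≤m)))
  (·-cong ≈-refl (one⊖mono-cong (cong suc (ℕ.m+[n∸m]≡n j≤m))))

tailProd-peel : ∀ {m j} → j < m → tailProd m j ≈ (one ⊖ mono (suc j)) · tailProd m (suc j)
tailProd-peel {m} {j} j<m = begin
  tailProd m j              ≈⟨ ≡⇒≈ (cong (∏ u) (ℕ.+-∸-assoc 1 j<m)) ⟩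
  ∏ u (suc (m ∸ suc j))     ≈⟨ ∏-shift u (m ∸ suc j) ⟩
  u 0 · ∏ (λ i → u (suc i)) (m ∸ suc j)
    ≈⟨ ·-cong (one⊖mono-cong (cong suc (ℕ.+-identityʳ j)))
              (∏-cong (λ i → one⊖mono-cong (cong suc (ℕ.+-suc j i))) (m ∸ suc j)) ⟩
  (one ⊖ mono (suc j)) · tailProd m (suc j) ∎
  where
  u : ℕ → Series
  u i = one ⊖ mono (suc (j + i))

tailProd-self : ∀ n → tailProd n n ≈ one
tailProd-self n = ≡⇒≈ (cong (∏ _) (ℕ.n∸n≡0 n))

tailProd-0 : ∀ n → tailProd n 0 ≈ eulerProd 1 n
tailProd-0 = ∏-cong λ i → one⊖mono-cong (sym (ℕ.*-identityˡ (suc i)))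

altProd : ℕ → Series
altProd zero    = one
altProd (suc j) = neg (altProd j · (one ⊕ mono j))

-- With (a)_j = (1 - a)(1 - aq)...(1 - aq^(j-1)), this is (q)_n/(q)_j · (-1)^j (-1)_j · q^((n+1)j)
-- for j ≤ n. The quotient (q)_n/(q)_j is written as `tailProd n j`, so that no division occurs.
shanksTerm : ℕ → ℕ → Series
shanksTerm n j = tailProd n j · altProd j · mono (suc n * j)

shanksSum : ℕ → ℕ → Series
shanksSum n zero    = shanksTerm n 0
shanksSum n (suc k) = shanksSum n k ⊕ shanksTerm n (suc k)

-- The ratio of consecutive right-hand sides in `shanks` suggests the factor 1 + q^(m+1). The defect
-- `shanksTerm (suc m) j` - (1 + q^(m+1)) `shanksTerm m j` telescopes in j, and the last summand is
-- its closed antidifference.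
shanksSum-telescope : ∀ {m} k → k ≤ m → shanksSum (suc m) k ≈
  (one ⊕ mono (suc m)) · shanksSum m k ⊕ tailProd m k · altProd (suc k) · mono (suc m * suc k)
shanksSum-telescope {m} zero _ = begin
  tailProd (suc m) 0 · one · mono (suc (suc m) * 0)
    ≈⟨ ·-cong (·-cong (tailProd-suc z≤n) ≈-refl) (mono-cong (ℕ.*-zeroʳ (suc (suc m)))) ⟩
  t · (one ⊖ Q) · one · one
    ≈⟨ solve 2 (λ t q → t :* (:1 :- q) :* :1 :* :1
                      := (:1 :+ q) :* (t :* :1 :* :1) :+ t :* (:- (:1 :* (:1 :+ :1))) :* q) ≈-refl t Q ⟩
  (one ⊕ Q) · (t · one · one) ⊕ t · neg (one · (one ⊕ one)) · Q
    ≈⟨ ⊕-cong (·-cong {one ⊕ Q} ≈-refl (·-cong ≈-refl (mono-cong (ℕ.*-zeroʳ (suc m)))))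
              (·-cong ≈-refl (mono-cong (ℕ.*-identityʳ (suc m)))) ⟨
  (one ⊕ Q) · (t · one · mono (suc m * 0)) ⊕ t · neg (one · (one ⊕ one)) · mono (suc m * 1) ∎
  where
  t = tailProd m 0
  Q = mono (suc m)
shanksSum-telescope {m} (suc k) k<m = begin
  shanksSum (suc m) k ⊕ tailProd (suc m) j · B · mono (suc (suc m) * j)
    ≈⟨ ⊕-cong (shanksSum-telescope k (ℕ.<⇒≤ k<m))
              (·-cong (·-cong (tailProd-suc k<m) ≈-refl) (≈-sym (mono-+ j (suc m * j)))) ⟩
  ((one ⊕ Q) · T ⊕ tailProd m k · B · W) ⊕ t · (one ⊖ Q) · B · (r · W)
    ≈⟨ ⊕-cong (⊕-cong {(one ⊕ Q) · T} ≈-refl (·-cong (·-cong (tailProd-peel k<m) ≈-refl) ≈-refl)) ≈-refl ⟩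
  ((one ⊕ Q) · T ⊕ (one ⊖ r) · t · B · W) ⊕ t · (one ⊖ Q) · B · (r · W)
    -- The old remainder and the new term combine because (1 - r) + r(1 - Q) = (1 + Q) - Q(1 + r).
    ≈⟨ solve 6 (λ q s t b r w →
         ((:1 :+ q) :* s :+ (:1 :- r) :* t :* b :* w) :+ t :* (:1 :- q) :* b :* (r :* w)
         := (:1 :+ q) :* (s :+ t :* b :* w) :+ t :* (:- (b :* (:1 :+ r))) :* (q :* w)) ≈-refl Q T t B r W ⟩
  (one ⊕ Q) · (T ⊕ t · B · W) ⊕ t · neg (B · (one ⊕ r)) · (Q · W)
    ≈⟨ ⊕-cong {(one ⊕ Q) · (T ⊕ t · B · W)} ≈-refl
         (·-cong ≈-refl (≈-trans (mono-+ (suc m) (suc m * j)) (mono-cong (sym (ℕ.*-suc (suc m) j))))) ⟩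
  (one ⊕ Q) · (T ⊕ t · B · W) ⊕ t · neg (B · (one ⊕ r)) · mono (suc m * suc j) ∎
  where
  j = suc k
  t = tailProd m j
  Q = mono (suc m)
  T = shanksSum m k
  B = altProd j
  r = mono j
  W = mono (suc m * j)

plusProd : ℕ → Series
plusProd = ∏ (λ i → one ⊕ mono (suc i))

-- The first factor of `altProd` is 1 + q⁰ = 2; it becomes the coefficient 2 with which j and -j
-- together enter the theta series.
altProd≈plusProd : ∀ m → altProd (suc m) ≈ const (+ 2 *ᶻ sign (suc m)) · plusProd m
altProd≈plusProd zero =
  solve 0 (:- (:1 :* (:1 :+ :1)) := con (-ᶻ (+ 2)) :* :1) ≈-refl
altProd≈plusProd (suc m) = begin
  neg (altProd (suc m) · (one ⊕ x))   ≈⟨ neg-cong (·-cong (altProd≈plusProd m) ≈-refl) ⟩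
  neg (k · plusProd m · (one ⊕ x))    ≈⟨ solve 3 (λ k p y → :- (k :* p :* y) := (:- k) :* (p :* y)) ≈-refl k (plusProd m) (one ⊕ x) ⟩
  neg k · plusProd (suc m)            ≈⟨ ·-cong k-neg ≈-refl ⟩
  const (+ 2 *ᶻ sign (suc (suc m))) · plusProd (suc m) ∎
  where
  x = mono (suc m)
  k = const (+ 2 *ᶻ sign (suc m))
  k-neg : neg k ≈ const (+ 2 *ᶻ sign (suc (suc m)))
  k-neg = coeffs λ { zero → ℤ.neg-distribʳ-* (+ 2) (sign (suc m)) ; (suc _) → refl }

-- At k = m the telescoping remainder is B q^(n²) and the one term still to be added is B q^n
-- q^(n²), where n = m + 1. Their sum contains the factor 1 + q^n that `plusProd` acquires.
shanks : ∀ n → shanksSum n n ≈ plusProd n · thetaSum sign n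
shanks zero    = ·-cong (·-identityˡ one) (≈-refl {one})
shanks (suc m) = begin
  shanksSum n m ⊕ tailProd n n · B · mono (suc n * n)
    ≈⟨ ⊕-cong (shanksSum-telescope m ℕ.≤-refl) (·-cong (·-cong (tailProd-self n) ≈-refl) (≈-sym (mono-+ n (n * n)))) ⟩
  ((one ⊕ Q) · shanksSum m m ⊕ tailProd m m · B · W) ⊕ one · B · (Q · W)
    ≈⟨ ⊕-cong (⊕-cong (·-cong {one ⊕ Q} ≈-refl (shanks m)) (·-cong (·-cong (tailProd-self m) ≈-refl) ≈-refl)) ≈-refl ⟩
  ((one ⊕ Q) · (H · S) ⊕ one · B · W) ⊕ one · B · (Q · W)
    ≈⟨ ⊕-cong (⊕-cong {(one ⊕ Q) · (H · S)} ≈-refl (·-cong (·-cong ≈-refl (altProd≈plusProd m)) ≈-refl))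
              (·-cong (·-cong ≈-refl (altProd≈plusProd m)) ≈-refl) ⟩
  ((one ⊕ Q) · (H · S) ⊕ one · (k · H) · W) ⊕ one · (k · H) · (Q · W)
    ≈⟨ solve 5 (λ q h s k w → ((:1 :+ q) :* (h :* s) :+ :1 :* (k :* h) :* w) :+ :1 :* (k :* h) :* (q :* w)
                            := h :* (:1 :+ q) :* (s :+ k :* w)) ≈-refl Q H S k W ⟩
  H · (one ⊕ Q) · (S ⊕ k · W) ∎
  where
  n = suc m
  Q = mono n
  B = altProd n
  W = mono (n * n)
  H = plusProd m
  S = thetaSum sign m
  k = const (+ 2 *ᶻ sign n)

-- Every term with j ≥ 1 is divisible by q^(n+1), so only the term j = 0 is visible.
shanksSum≈[] : ∀ n k → shanksSum n k ≈[ n ] eulerProd 1 n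
shanksSum≈[] n zero    = ≈⇒≈[] (begin
  tailProd n 0 · one · mono (suc n * 0)  ≈⟨ ·-cong (·-identityʳ _) (mono-cong (ℕ.*-zeroʳ (suc n))) ⟩
  tailProd n 0 · one                     ≈⟨ ·-identityʳ _ ⟩
  tailProd n 0                           ≈⟨ tailProd-0 n ⟩
  eulerProd 1 n                          ∎)
shanksSum≈[] n (suc k) = ≈[]-trans
  (⊕-cong≤ (shanksSum≈[] n k) (·-mono≈[]0 (tailProd n (suc k) · altProd (suc k)) (ℕ.m≤m*n (suc n) (suc k))))
  (≈⇒≈[] (coeffs λ i → ℤ.+-identityʳ (eulerProd 1 n i)))

eulerProd-plusProd : ∀ n → eulerProd 1 n · plusProd n ≈ eulerProd 2 n
eulerProd-plusProd n = ≈-trans (≈-sym (∏-distrib-· _ _ n)) (∏-cong factor n)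
  where
  factor : ∀ j → (one ⊖ mono (1 * suc j)) · (one ⊕ mono (suc j)) ≈ one ⊖ mono (2 * suc j)
  factor j = begin
    (one ⊖ mono (1 * suc j)) · (one ⊕ x) ≈⟨ ·-cong (one⊖mono-cong (ℕ.*-identityˡ (suc j))) ≈-refl ⟩
    (one ⊖ x) · (one ⊕ x)                ≈⟨ one⊖-· x ⟩
    one ⊖ x · x                          ≈⟨ ⊖-cong {one} ≈-refl (mono-+ (suc j) (suc j)) ⟩
    one ⊖ mono (suc j + suc j)           ≈⟨ one⊖mono-cong (double (suc j)) ⟨
    one ⊖ mono (2 * suc j)               ∎
    where x = mono (suc j)

-- Modulo q^(N+1), Shanks' identity says that (q)_N is (-q)_N φ(-q). Multiplying by (q)_N turns the
-- right side into f₂ φ(-q), since the factors pair up as (1 - q^j)(1 + q^j) = 1 - q^(2j).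
gauss : f 2 · theta sign ≈ f 1 · f 1
gauss = ≈[]⇒≈ λ N → let
    module ≤N = ≈[]-Reasoning N
    P = eulerProd 1 N
    S = thetaSum sign N
  in ≤N.begin
  f 2 · theta sign            ≤N.≈⟨ ·-cong≤ (f≈[]eulerProd 1 ℕ.≤-refl) (lim≈[] (thetaSum-stable sign) ℕ.≤-refl) ⟩
  eulerProd 2 N · S           ≤N.≈⟨ ≈⇒≈[] (·-cong (≈-sym (eulerProd-plusProd N)) ≈-refl) ⟩
  P · plusProd N · S          ≤N.≈⟨ ≈⇒≈[] (·-assoc P (plusProd N) S) ⟩
  P · (plusProd N · S)        ≤N.≈⟨ ≈⇒≈[] (·-cong ≈-refl (≈-sym (shanks N))) ⟩
  P · shanksSum N N           ≤N.≈⟨ ·-cong≤ (≈[]-refl {x = P}) (shanksSum≈[] N N) ⟩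
  P · P                       ≤N.≈⟨ ·-cong≤ (f≈[]eulerProd 0 ℕ.≤-refl) (f≈[]eulerProd 0 ℕ.≤-refl) ⟨
  f 1 · f 1                   ≤N.∎

-- φ(q), φ(-q) and their sum

all-ones : ℕ → ℤ
all-ones _ = + 1

-- The substitution multiplies q^(j²) by (-1)^(j²), which is (-1)^j because j² and j have the same
-- parity; this cancels the sign already present.
sgn-thetaSum : ∀ n → sgn (thetaSum sign n) ≈ thetaSum all-ones n
sgn-thetaSum zero    = sgn-one
sgn-thetaSum (suc n) = begin
  sgn (thetaSum sign n ⊕ k · x)             ≈⟨ sgn-⊕ (thetaSum sign n) (k · x) ⟩
  sgn (thetaSum sign n) ⊕ sgn (k · x)       ≈⟨ ⊕-cong (sgn-thetaSum n) sgn-term ⟩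
  thetaSum all-ones n ⊕ const (+ 2) · x     ∎
  where
  s = sign (suc n)
  k = const (+ 2 *ᶻ s)
  x = mono (suc n * suc n)
  sgn-term : sgn (k · x) ≈ const (+ 2) · x
  sgn-term = begin
    sgn (k · x)                      ≈⟨ sgn-cong (const-· (+ 2 *ᶻ s) x) ⟩
    sgn (scale (+ 2 *ᶻ s) x)         ≈⟨ sgn-scale (+ 2 *ᶻ s) x ⟩
    scale (+ 2 *ᶻ s) (sgn x)         ≈⟨ const-· (+ 2 *ᶻ s) (sgn x) ⟨
    k · sgn x                        ≈⟨ ·-cong ≈-refl (sgn-mono (suc n * suc n)) ⟩
    k · (const (sign (suc n * suc n)) · x) ≈⟨ ·-cong ≈-refl (·-cong (≡⇒≈ (cong const (sign-square (suc n)))) ≈-refl) ⟩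
    k · (const s · x)                ≈⟨ ·-assoc k (const s) x ⟨
    k · const s · x                  ≈⟨ ·-cong (const-* (+ 2 *ᶻ s) s) ≈-refl ⟩
    const (+ 2 *ᶻ s *ᶻ s) · x        ≈⟨ ·-cong (≡⇒≈ (cong const 2ss)) ≈-refl ⟩
    const (+ 2) · x                  ∎
    where
    open _-Raw-AlmostCommutative⟶_ const-morphism using (*-homo)
    const-* : ∀ k l → const k · const l ≈ const (k *ᶻ l)
    const-* k l = ≈-sym (*-homo k l)
    2ss : + 2 *ᶻ s *ᶻ s ≡ + 2
    2ss = trans (ℤ.*-assoc (+ 2) s s)
      (cong (+ 2 *ᶻ_) (trans (sym (sign-+ (suc n) (suc n))) (sign-double (suc n))))

sgn-theta : sgn (theta sign) ≈ theta all-ones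
sgn-theta = ≈[]⇒≈ λ N → ≈[]-trans (sgn-cong≤ (lim≈[] (thetaSum-stable sign) ℕ.≤-refl))
  (≈[]-trans (≈⇒≈[] (sgn-thetaSum N)) (≈[]-sym (lim≈[] (thetaSum-stable all-ones) ℕ.≤-refl)))

-- Odd j cancel. Even j = 2i contribute twice, with exponent (2i)² = 4i², whence the two dilations;
-- the induction step adds one odd and one even index.
thetaSum-even : ∀ n → thetaSum all-ones (n + n) ⊕ thetaSum sign (n + n) ≈ const (+ 2) · dil (dil (thetaSum all-ones n))
thetaSum-even zero    = begin
  one ⊕ one               ≈⟨ solve 0 (:1 :+ :1 := con (+ 2) :* :1) ≈-refl ⟩
  const (+ 2) · one       ≈⟨ ·-cong ≈-refl (≈-trans (dil-cong (dil-mono 0)) (dil-mono 0)) ⟨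
  const (+ 2) · dil (dil one) ∎
thetaSum-even (suc n) = begin
  thetaSum all-ones (suc n + suc n) ⊕ thetaSum sign (suc n + suc n)
    ≈⟨ ≡⇒≈ (cong (λ m → thetaSum all-ones (suc m) ⊕ thetaSum sign (suc m)) (ℕ.+-suc n n)) ⟩
  (T ⊕ k₂ · x ⊕ k₂ · y) ⊕ (S ⊕ const (+ 2 *ᶻ sign (suc (n + n))) · x ⊕ const (+ 2 *ᶻ sign (2 + (n + n))) · y)
    ≈⟨ ⊕-cong {T ⊕ k₂ · x ⊕ k₂ · y} ≈-refl
         (⊕-cong (⊕-cong {S} ≈-refl (·-cong (≡⇒≈ (cong (λ t → const (+ 2 *ᶻ -ᶻ t)) (sign-double n))) ≈-refl))
                 (·-cong (≡⇒≈ (cong (λ t → const (+ 2 *ᶻ -ᶻ (-ᶻ t))) (sign-double n))) ≈-refl)) ⟩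
  (T ⊕ k₂ · x ⊕ k₂ · y) ⊕ (S ⊕ const (+ 2 *ᶻ -ᶻ (+ 1)) · x ⊕ const (+ 2 *ᶻ -ᶻ (-ᶻ (+ 1))) · y)
    ≈⟨ solve 4 (λ t s x y → (t :+ con (+ 2) :* x :+ con (+ 2) :* y) :+ (s :+ con (-ᶻ (+ 2)) :* x :+ con (+ 2) :* y)
                         := (t :+ s) :+ con (+ 2) :* (con (+ 2) :* y)) ≈-refl T S x y ⟩
  (T ⊕ S) ⊕ k₂ · (k₂ · y)
    ≈⟨ ⊕-cong (thetaSum-even n) (·-cong ≈-refl (·-cong ≈-refl y-dil)) ⟩
  k₂ · dil (dil U) ⊕ k₂ · (k₂ · dil (dil z))
    ≈⟨ ·-distribˡ k₂ (dil (dil U)) (k₂ · dil (dil z)) ⟨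
  k₂ · (dil (dil U) ⊕ k₂ · dil (dil z))
    ≈⟨ ·-cong ≈-refl (⊕-cong {dil (dil U)} ≈-refl (≈-trans (·-cong (≈-sym (≈-trans (dil-cong (dil-const (+ 2))) (dil-const (+ 2)))) ≈-refl) (≈-sym (≈-trans (dil-cong (dil-· k₂ z)) (dil-· (dil k₂) (dil z)))))) ⟩
  k₂ · (dil (dil U) ⊕ dil (dil (k₂ · z)))
    ≈⟨ ·-cong ≈-refl (≈-trans (dil-cong (dil-⊕ U (k₂ · z))) (dil-⊕ (dil U) (dil (k₂ · z)))) ⟨
  k₂ · dil (dil (U ⊕ k₂ · z)) ∎
  where
  k₂ = const (+ 2)
  T = thetaSum all-ones (n + n)
  S = thetaSum sign (n + n)
  U = thetaSum all-ones n
  x = mono (suc (n + n) * suc (n + n))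
  y = mono (suc (suc (n + n)) * suc (suc (n + n)))
  z = mono (suc n * suc n)
  square-double : ∀ j → (j + j) * (j + j) ≡ (j * j + j * j) + (j * j + j * j)
  square-double j = trans (ℕ.*-distribʳ-+ (j + j) j j) (cong₂ _+_ (ℕ.*-distribˡ-+ j j j) (ℕ.*-distribˡ-+ j j j))
  y-dil : y ≈ dil (dil z)
  y-dil = begin
    y                                  ≈⟨ mono-cong (cong (λ m → m * m) (cong suc (sym (ℕ.+-suc n n)))) ⟩
    mono ((suc n + suc n) * (suc n + suc n)) ≈⟨ mono-cong (square-double (suc n)) ⟩
    mono ((s² + s²) + (s² + s²))       ≈⟨ dil-mono (s² + s²) ⟨
    dil (mono (s² + s²))               ≈⟨ dil-cong (dil-mono s²) ⟨
    dil (dil z)                        ∎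
    where s² = suc n * suc n

theta-even : theta all-ones ⊕ theta sign ≈ const (+ 2) · dil (dil (theta all-ones))
theta-even = ≈[]⇒≈ λ N → let
    module ≤N = ≈[]-Reasoning N
    approx : ∀ ε {m} → N ≤ m → theta ε ≈[ N ] thetaSum ε m
    approx ε = lim≈[] (thetaSum-stable ε)
    N≤2N = ℕ.m≤m+n N N
  in ≤N.begin
  theta all-ones ⊕ theta sign
    ≤N.≈⟨ ⊕-cong≤ (approx all-ones N≤2N) (approx sign N≤2N) ⟩
  thetaSum all-ones (N + N) ⊕ thetaSum sign (N + N)
    ≤N.≈⟨ ≈⇒≈[] (thetaSum-even N) ⟩
  const (+ 2) · dil (dil (thetaSum all-ones N))
    ≤N.≈⟨ ·-cong≤ (≈[]-refl {x = const (+ 2)}) (dil-cong≤ (dil-cong≤ (approx all-ones ℕ.≤-refl))) ⟨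
  const (+ 2) · dil (dil (theta all-ones)) ≤N.∎

-- Uniqueness of solutions of functional equations relating a series to its dilation

dil≡0 : ∀ n {a : Series} → (∀ j → j + j ≡ n → a j ≡ + 0) → dil a n ≡ + 0
dil≡0 zero          p = p 0 refl
dil≡0 (suc zero)    p = refl
dil≡0 (suc (suc n)) p = dil≡0 n λ j j+j≡n → p (suc j) (cong suc (trans (ℕ.+-suc j j) (cong suc j+j≡n)))

x≡k*x⇒x≡0 : ∀ {k} → k ≢ + 1 → ∀ x → x ≡ k *ᶻ x → x ≡ + 0
x≡k*x⇒x≡0 {k} k≢1 x eq with x ℤ.≟ + 0
... | yes x≡0 = x≡0
... | no  x≢0 = contradiction (sym (ℤ.*-cancelʳ-≡ (+ 1) k x {{≢-nonZero x≢0}} (trans (ℤ.*-identityˡ x) eq))) k≢1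

-- The constant term satisfies a₀ = k a₀, which is where k ≠ 1 enters. A coefficient of positive
-- degree n is 0 or k times the one of degree n/2 < n.
≈k·dil⇒≈0 : ∀ {k} → k ≢ + 1 → a ≈ const k · dil a → a ≈ zeroS
≈k·dil⇒≈0 {a} {k} k≢1 p = ≈[]⇒≈ λ N → coeffs≤ (vanish N)
  where
  eq : ∀ n → a n ≡ k *ᶻ dil a n
  eq n = trans (coeff p n) (coeff (const-· k (dil a)) n)
  a₀ : a 0 ≡ + 0
  a₀ = x≡k*x⇒x≡0 k≢1 (a 0) (eq 0)
  vanish : ∀ N n → n ≤ N → a n ≡ + 0
  vanish N       zero    _         = a₀
  vanish (suc N) (suc n) (s≤s n≤N) = trans (eq (suc n))
    (trans (cong (k *ᶻ_) (dil≡0 (suc n) half)) (ℤ.*-zeroʳ k))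
    where
    half : ∀ j → j + j ≡ suc n → a j ≡ + 0
    half zero    _     = a₀
    half (suc j) j+j≡n = vanish N (suc j)
      (ℕ.≤-trans (ℕ.m≤n+m (suc j) j) (ℕ.≤-trans (ℕ.≤-reflexive (ℕ.suc-injective j+j≡n)) n≤N))

opaque
  unfolding _·_

  ·-second : ∀ {k} (a b : Series) → a ≈[ k ] zeroS →
             (a · b) (2 + k) ≡ a (1 + k) *ᶻ b 1 +ᶻ a (2 + k) *ᶻ b 0
  ·-second {k} a b p = cong₂ _+ᶻ_
    (trans (cong₂ _+ᶻ_
             (trans (sumTo-cong≤ k λ i i≤k → cong (_*ᶻ b (2 + k ∸ i)) (coeff≤ p i i≤k)) (sumTo-0 k))
             (cong (λ j → a (1 + k) *ᶻ b j) (ℕ.m+n∸n≡m 1 k)))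
           (ℤ.+-identityˡ (a (1 + k) *ᶻ b 1)))
    (cong (λ j → a (2 + k) *ᶻ b j) (ℕ.n∸n≡0 k))

-- If the lowest term of a is cq^k with k ≥ 2, then it has degree k + 1 in a · u but at least 2k in v · dil a.
·≈·dil⇒≈0 : ∀ a u v → a ≈[ 1 ] zeroS → u 0 ≡ + 0 → u 1 ≢ + 0 → a · u ≈ v · dil a → a ≈ zeroS
·≈·dil⇒≈0 a u v base u₀ u₁ p = ≈[]⇒≈ λ N → coeffs≤ λ n n≤N → coeff≤ (vanish N) n (ℕ.m≤n⇒m≤1+n n≤N)
  where
  vanish : ∀ k → a ≈[ suc k ] zeroS
  vanish zero    = base
  vanish (suc k) = coeffs≤ λ n n≤2+k → extend n (ℕ.m≤n⇒m<n∨m≡n n≤2+k)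
    where
    half : ∀ n → n ≤ 3 + k → ∀ j → j + j ≡ n → a j ≡ + 0
    half n n≤3+k j j+j≡n with j ℕ.≤? suc k
    ... | yes j≤1+k = coeff≤ (vanish k) j j≤1+k
    ... | no  j≰1+k = contradiction n≤3+k (ℕ.<⇒≱ (ℕ.<-≤-trans
            (s≤s (s≤s (ℕ.m≤n+m (2 + k) k)))
            (ℕ.≤-trans (ℕ.+-mono-≤ (ℕ.≰⇒> j≰1+k) (ℕ.≰⇒> j≰1+k)) (ℕ.≤-reflexive j+j≡n))))
    dil-a : dil a ≈[ 3 + k ] zeroS
    dil-a = coeffs≤ λ n n≤3+k → dil≡0 n (half n n≤3+k)
    au₁≡0 : a (2 + k) *ᶻ u 1 ≡ + 0
    au₁≡0 = ≡.begin
      a (2 + k) *ᶻ u 1                            ≡.≡⟨ ℤ.+-identityʳ _ ⟨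
      a (2 + k) *ᶻ u 1 +ᶻ + 0                     ≡.≡⟨ cong (a (2 + k) *ᶻ u 1 +ᶻ_) (trans (cong (a (3 + k) *ᶻ_) u₀) (ℤ.*-zeroʳ (a (3 + k)))) ⟨
      a (2 + k) *ᶻ u 1 +ᶻ a (3 + k) *ᶻ u 0        ≡.≡⟨ ·-second a u (vanish k) ⟨
      (a · u) (3 + k)                             ≡.≡⟨ coeff p (3 + k) ⟩
      (v · dil a) (3 + k)                         ≡.≡⟨ coeff≤ (·-cong≤ (≈[]-refl {x = v}) dil-a) (3 + k) ℕ.≤-refl ⟩
      (v · zeroS) (3 + k)                         ≡.≡⟨ coeff (·-zeroʳ v) (3 + k) ⟩
      + 0                                         ≡.∎
    a₂₊ₖ≡0 : a (2 + k) ≡ + 0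
    a₂₊ₖ≡0 with ℤ.i*j≡0⇒i≡0∨j≡0 (a (2 + k)) au₁≡0
    ... | inj₁ a≡0 = a≡0
    ... | inj₂ u≡0 = contradiction u≡0 u₁
    extend : ∀ n → n < 2 + k ⊎ n ≡ 2 + k → a n ≡ + 0
    extend n (inj₁ (s≤s n≤1+k)) = coeff≤ (vanish k) n n≤1+k
    extend n (inj₂ refl)        = a₂₊ₖ≡0

-- Jacobi's identity

F₁ F₂ F₄ F₈ G₁ G₂ : Series
F₁ = f 1
F₂ = f 2
F₄ = dil F₂
F₈ = dil F₄
G₁ = sgn F₁
G₂ = dil G₁

dil-F₁ : dil F₁ ≈ F₂
dil-F₁ = ≈-sym f₂≈dil-f₁

sgn-F₂ : sgn F₂ ≈ F₂
sgn-F₂ = ≈-trans (sgn-cong f₂≈dil-f₁) (≈-trans (sgn-dil F₁) dil-F₁)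

φ φ⁻ : Series
φ  = theta all-ones
φ⁻ = theta sign

F₂·φ : F₂ · φ ≈ G₁ · G₁
F₂·φ = begin
  F₂ · φ            ≈⟨ ·-cong sgn-F₂ sgn-theta ⟨
  sgn F₂ · sgn φ⁻   ≈⟨ sgn-· F₂ φ⁻ ⟨
  sgn (F₂ · φ⁻)     ≈⟨ sgn-cong gauss ⟩
  sgn (F₁ · F₁)     ≈⟨ sgn-· F₁ F₁ ⟩
  G₁ · G₁           ∎

F₄·dil-φ : F₄ · dil φ ≈ G₂ · G₂
F₄·dil-φ = ≈-trans (≈-sym (dil-· F₂ φ)) (≈-trans (dil-cong F₂·φ) (dil-· G₁ G₁))

F₄·dil-φ⁻ : F₄ · dil φ⁻ ≈ F₂ · F₂
F₄·dil-φ⁻ = ≈-trans (≈-sym (dil-· F₂ φ⁻))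
  (≈-trans (dil-cong gauss) (≈-trans (dil-· F₁ F₁) (·-cong dil-F₁ dil-F₁)))

·-one : ∀ a b → a 0 ≡ + 1 → b 0 ≡ + 1 → (a · b) 0 ≡ + 1
·-one a b a₀ b₀ = trans (·-zero a b) (cong₂ _*ᶻ_ a₀ b₀)

-- Multiplied by (F₂F₄)², both sides equal F₂⁶: the left by Gauss's identity at q and -q followed by
-- `f-sgn`, the right by Gauss's identity at q². The multiplier has constant term 1 and can be
-- cancelled.
φ·φ⁻ : φ · φ⁻ ≈ dil φ⁻ · dil φ⁻
φ·φ⁻ = ·-cancelˡ {u · u} (·-one u u u₀ u₀) (begin
  u · u · (φ · φ⁻)
    ≈⟨ solve 4 (λ x y a b → (x :* y) :* (x :* y) :* (a :* b) := (x :* a) :* (x :* b) :* (y :* y)) ≈-refl F₂ F₄ φ φ⁻ ⟩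
  (F₂ · φ) · (F₂ · φ⁻) · (F₄ · F₄)        ≈⟨ ·-cong (·-cong F₂·φ gauss) ≈-refl ⟩
  (G₁ · G₁) · (F₁ · F₁) · (F₄ · F₄)
    ≈⟨ solve 3 (λ x y z → (y :* y) :* (x :* x) :* (z :* z) := (x :* y :* z) :* (x :* y :* z)) ≈-refl F₁ G₁ F₄ ⟩
  (F₁ · G₁ · F₄) · (F₁ · G₁ · F₄)         ≈⟨ ·-cong f-sgn f-sgn ⟩
  F₂ ^ 3 · F₂ ^ 3
    ≈⟨ solve 1 (λ x → x :^ 3 :* x :^ 3 := (x :* x) :* (x :* x) :* (x :* x)) ≈-refl F₂ ⟩
  (F₂ · F₂) · (F₂ · F₂) · (F₂ · F₂)       ≈⟨ ·-cong (·-cong ≈-refl F₄·dil-φ⁻) F₄·dil-φ⁻ ⟨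
  (F₂ · F₂) · (F₄ · dil φ⁻) · (F₄ · dil φ⁻)
    ≈⟨ solve 3 (λ x y d → (x :* x) :* (y :* d) :* (y :* d) := (x :* y) :* (x :* y) :* (d :* d)) ≈-refl F₂ F₄ (dil φ⁻) ⟩
  u · u · (dil φ⁻ · dil φ⁻) ∎)
  where
  u = F₂ · F₄
  u₀ : u 0 ≡ + 1
  u₀ = ·-one F₂ F₄ refl refl

φ²+φ⁻² : φ · φ ⊕ φ⁻ · φ⁻ ≈ const (+ 2) · (dil φ · dil φ)
φ²+φ⁻² = begin
  φ · φ ⊕ φ⁻ · φ⁻
    ≈⟨ solve 3 (λ a b x → a :* a :+ b :* b
         := (a :* a :+ b :* b :- con (+ 2) :* x) :+ con (+ 2) :* x) ≈-refl φ φ⁻ (dil φ · dil φ) ⟩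
  D ⊕ const (+ 2) · (dil φ · dil φ)       ≈⟨ ⊕-cong (≈k·dil⇒≈0 {k = -ᶻ + 2} (λ ()) D-descent) ≈-refl ⟩
  zeroS ⊕ const (+ 2) · (dil φ · dil φ)   ≈⟨ coeffs (λ n → ℤ.+-identityˡ _) ⟩
  const (+ 2) · (dil φ · dil φ)           ∎
  where
  φ₂ = dil φ
  φ₂⁻ = dil φ⁻
  φ₄ = dil φ₂
  D = φ · φ ⊕ φ⁻ · φ⁻ ⊖ const (+ 2) · (φ₂ · φ₂)
  dil-D : dil D ≈ φ₂ · φ₂ ⊕ φ₂⁻ · φ₂⁻ ⊖ const (+ 2) · (φ₄ · φ₄)
  dil-D = begin
    dil D
      ≈⟨ dil-⊖ (φ · φ ⊕ φ⁻ · φ⁻) (const (+ 2) · (φ₂ · φ₂)) ⟩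
    dil (φ · φ ⊕ φ⁻ · φ⁻) ⊖ dil (const (+ 2) · (φ₂ · φ₂))
      ≈⟨ ⊖-cong (≈-trans (dil-⊕ (φ · φ) (φ⁻ · φ⁻)) (⊕-cong (dil-· φ φ) (dil-· φ⁻ φ⁻)))
                (≈-trans (dil-· (const (+ 2)) (φ₂ · φ₂)) (·-cong (dil-const (+ 2)) (dil-· φ₂ φ₂))) ⟩
    φ₂ · φ₂ ⊕ φ₂⁻ · φ₂⁻ ⊖ const (+ 2) · (φ₄ · φ₄) ∎
  -- From a² + b² = (a + b)² - 2ab, D becomes 4φ(q⁴)² - 2φ(-q²)² - 2φ(q²)². The term subtracted in D
  -- has thus become one of the squares of D(q²), and the square of the sum supplies its φ(q⁴)².
  D-descent : D ≈ const (-ᶻ + 2) · dil D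
  D-descent = begin
    D
      ≈⟨ solve 3 (λ a b x → a :* a :+ b :* b :- con (+ 2) :* x
           := (a :+ b) :* (a :+ b) :- con (+ 2) :* (a :* b) :- con (+ 2) :* x) ≈-refl φ φ⁻ (φ₂ · φ₂) ⟩
    (φ ⊕ φ⁻) · (φ ⊕ φ⁻) ⊖ const (+ 2) · (φ · φ⁻) ⊖ const (+ 2) · (φ₂ · φ₂)
      ≈⟨ ⊖-cong (⊖-cong (·-cong theta-even theta-even) (·-cong ≈-refl φ·φ⁻)) ≈-refl ⟩
    (const (+ 2) · φ₄) · (const (+ 2) · φ₄) ⊖ const (+ 2) · (φ₂⁻ · φ₂⁻) ⊖ const (+ 2) · (φ₂ · φ₂)
      ≈⟨ solve 3 (λ c d e → (con (+ 2) :* e) :* (con (+ 2) :* e) :- con (+ 2) :* (d :* d) :- con (+ 2) :* (c :* c)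
           := con (-ᶻ + 2) :* (c :* c :+ d :* d :- con (+ 2) :* (e :* e))) ≈-refl φ₂ φ₂⁻ φ₄ ⟩
    const (-ᶻ + 2) · (φ₂ · φ₂ ⊕ φ₂⁻ · φ₂⁻ ⊖ const (+ 2) · (φ₄ · φ₄))
      ≈⟨ ·-cong ≈-refl dil-D ⟨
    const (-ᶻ + 2) · dil D ∎

-- Factor a⁴ - b⁴ = (a² + b²)(a² - b²) and use (a² - b²)² = (a² + b²)² - 4(ab)², so that only the
-- known a² + b² and ab remain.
φ⁴-φ⁻⁴ : (φ ^ 4 ⊖ φ⁻ ^ 4) ^ 2 ≈ const (+ 16) · dil φ ^ 4 · (dil φ ^ 4 ⊖ dil φ⁻ ^ 4)
φ⁴-φ⁻⁴ = begin
  (φ ^ 4 ⊖ φ⁻ ^ 4) ^ 2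
    ≈⟨ solve 2 (λ a b → (a :^ 4 :- b :^ 4) :^ 2
         := (a :* a :+ b :* b) :^ 2 :* ((a :* a :+ b :* b) :^ 2 :- con (+ 4) :* (a :* b) :^ 2)) ≈-refl φ φ⁻ ⟩
  (φ · φ ⊕ φ⁻ · φ⁻) ^ 2 · ((φ · φ ⊕ φ⁻ · φ⁻) ^ 2 ⊖ const (+ 4) · (φ · φ⁻) ^ 2)
    ≈⟨ ·-cong (^-congˡ 2 φ²+φ⁻²) (⊖-cong (^-congˡ 2 φ²+φ⁻²) (·-cong ≈-refl (^-congˡ 2 φ·φ⁻))) ⟩
  (const (+ 2) · (φ₂ · φ₂)) ^ 2 · ((const (+ 2) · (φ₂ · φ₂)) ^ 2 ⊖ const (+ 4) · (φ₂⁻ · φ₂⁻) ^ 2)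
    ≈⟨ solve 2 (λ c d → (con (+ 2) :* (c :* c)) :^ 2 :* ((con (+ 2) :* (c :* c)) :^ 2 :- con (+ 4) :* (d :* d) :^ 2)
         := con (+ 16) :* c :^ 4 :* (c :^ 4 :- d :^ 4)) ≈-refl φ₂ φ₂⁻ ⟩
  const (+ 16) · φ₂ ^ 4 · (φ₂ ^ 4 ⊖ φ₂⁻ ^ 4) ∎
  where
  φ₂ = dil φ
  φ₂⁻ = dil φ⁻

J T : Series
J = G₁ ^ 8 ⊖ F₁ ^ 8
T = const (+ 16) · (q · F₄ ^ 8)

^4-double : ∀ x → (x · x) ^ 4 ≈ x ^ 8
^4-double = solve 1 (λ x → (x :* x) :^ 4 := x :^ 8) ≈-refl

-- By Gauss, J = F₂⁴ E. The equation for E is multiplied by F₂⁸F₄⁸: F₂⁸ turns E² into J², while one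
-- F₄⁴ turns φ(q²)⁴ into G₂⁸ and the other turns E(q²) into J(q²).
J²-dil : J ^ 2 · F₄ ^ 8 ≈ const (+ 16) · (G₂ · F₂) ^ 8 · dil J
J²-dil = begin
  J ^ 2 · F₄ ^ 8
    ≈⟨ ·-cong (^-congˡ 2 (⊖-cong (pullback F₂·φ) (pullback gauss))) ≈-refl ⟨
  ((F₂ · φ) ^ 4 ⊖ (F₂ · φ⁻) ^ 4) ^ 2 · F₄ ^ 8
    ≈⟨ solve 4 (λ x y a b → ((x :* a) :^ 4 :- (x :* b) :^ 4) :^ 2 :* y :^ 8
         := x :^ 8 :* y :^ 8 :* (a :^ 4 :- b :^ 4) :^ 2) ≈-refl F₂ F₄ φ φ⁻ ⟩
  F₂ ^ 8 · F₄ ^ 8 · (φ ^ 4 ⊖ φ⁻ ^ 4) ^ 2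
    ≈⟨ ·-cong ≈-refl φ⁴-φ⁻⁴ ⟩
  F₂ ^ 8 · F₄ ^ 8 · (const (+ 16) · φ₂ ^ 4 · (φ₂ ^ 4 ⊖ φ₂⁻ ^ 4))
    ≈⟨ solve 4 (λ x y c d → x :^ 8 :* y :^ 8 :* (con (+ 16) :* c :^ 4 :* (c :^ 4 :- d :^ 4))
         := con (+ 16) :* ((y :* c) :^ 4 :* x :^ 8) :* ((y :* c) :^ 4 :- (y :* d) :^ 4)) ≈-refl F₂ F₄ φ₂ φ₂⁻ ⟩
  const (+ 16) · ((F₄ · φ₂) ^ 4 · F₂ ^ 8) · ((F₄ · φ₂) ^ 4 ⊖ (F₄ · φ₂⁻) ^ 4)
    ≈⟨ ·-cong (·-cong ≈-refl (·-cong (pullback F₄·dil-φ) ≈-refl)) (⊖-cong (pullback F₄·dil-φ) (pullback F₄·dil-φ⁻)) ⟩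
  const (+ 16) · (G₂ ^ 8 · F₂ ^ 8) · (G₂ ^ 8 ⊖ F₂ ^ 8)
    ≈⟨ ·-cong (·-cong ≈-refl (≈-sym (^-distrib-* G₂ F₂ 8))) dil-J ⟩
  const (+ 16) · (G₂ · F₂) ^ 8 · dil J ∎
  where
  φ₂ = dil φ
  φ₂⁻ = dil φ⁻
  pullback : ∀ {x y} → x ≈ y · y → x ^ 4 ≈ y ^ 8
  pullback {x} {y} p = ≈-trans (^-congˡ 4 p) (^4-double y)
  dil-J : G₂ ^ 8 ⊖ F₂ ^ 8 ≈ dil J
  dil-J = ≈-sym (≈-trans (dil-⊖ (G₁ ^ 8) (F₁ ^ 8))
    (⊖-cong (dil-^ G₁ 8) (≈-trans (dil-^ F₁ 8) (^-congˡ 8 dil-F₁))))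

-- The left side is 16² q² F₄²⁴, and `f-sgn` at q² rewrites F₄³ as G₂F₂F₈.
T²-dil : T ^ 2 · F₄ ^ 8 ≈ const (+ 16) · (G₂ · F₂) ^ 8 · dil T
T²-dil = begin
  T ^ 2 · F₄ ^ 8
    ≈⟨ solve 2 (λ q x → (con (+ 16) :* (q :* x)) :^ 2 :* x := con (+ 16) :* (con (+ 16) :* ((q :* q) :* x :^ 3))) ≈-refl q (F₄ ^ 8) ⟩
  const (+ 16) · (const (+ 16) · ((q · q) · (F₄ ^ 8) ^ 3))
    ≈⟨ ·-cong ≈-refl (·-cong ≈-refl (·-cong ≈-refl (≈-trans (^-assocʳ F₄ 8 3) (≈-sym (^-assocʳ F₄ 3 8))))) ⟩
  const (+ 16) · (const (+ 16) · ((q · q) · (F₄ ^ 3) ^ 8))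
    ≈⟨ ·-cong ≈-refl (·-cong ≈-refl (·-cong ≈-refl (^-congˡ 8 f-sgn₂))) ⟨
  const (+ 16) · (const (+ 16) · ((q · q) · (G₂ · F₂ · F₈) ^ 8))
    ≈⟨ ·-cong ≈-refl (·-cong ≈-refl (·-cong ≈-refl (^-distrib-* (G₂ · F₂) F₈ 8))) ⟩
  const (+ 16) · (const (+ 16) · ((q · q) · ((G₂ · F₂) ^ 8 · F₈ ^ 8)))
    ≈⟨ solve 4 (λ k q x y → k :* (k :* (q :* (x :* y))) := k :* x :* (k :* (q :* y))) ≈-refl
         (const (+ 16)) (q · q) ((G₂ · F₂) ^ 8) (F₈ ^ 8) ⟩
  const (+ 16) · (G₂ · F₂) ^ 8 · (const (+ 16) · ((q · q) · F₈ ^ 8))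
    ≈⟨ ·-cong ≈-refl dil-T ⟨
  const (+ 16) · (G₂ · F₂) ^ 8 · dil T ∎
  where
  f-sgn₂ : G₂ · F₂ · F₈ ≈ F₄ ^ 3
  f-sgn₂ = begin
    G₂ · F₂ · F₈              ≈⟨ ·-cong (≈-trans (·-comm G₂ F₂) (·-cong (≈-sym dil-F₁) ≈-refl)) ≈-refl ⟩
    dil F₁ · G₂ · F₈          ≈⟨ ·-cong (dil-· F₁ G₁) ≈-refl ⟨
    dil (F₁ · G₁) · F₈        ≈⟨ dil-· (F₁ · G₁) F₄ ⟨
    dil (F₁ · G₁ · F₄)        ≈⟨ dil-cong f-sgn ⟩
    dil (F₂ ^ 3)              ≈⟨ dil-^ F₂ 3 ⟩
    F₄ ^ 3                    ∎
  dil-T : dil T ≈ const (+ 16) · ((q · q) · F₈ ^ 8)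
  dil-T = begin
    dil T                                  ≈⟨ dil-· (const (+ 16)) (q · F₄ ^ 8) ⟩
    dil (const (+ 16)) · dil (q · F₄ ^ 8)  ≈⟨ ·-cong (dil-const (+ 16)) (dil-· q (F₄ ^ 8)) ⟩
    const (+ 16) · (dil q · dil (F₄ ^ 8))
      ≈⟨ ·-cong ≈-refl (·-cong (≈-trans (dil-mono 1) (≈-sym (mono-+ 1 1))) (dil-^ F₄ 8)) ⟩
    const (+ 16) · ((q · q) · F₈ ^ 8)      ∎

q·-suc : ∀ a n → (q · a) (suc n) ≡ a n
q·-suc a n = trans (mono-suc-· 0 a n) (coeff (·-identityˡ a) n)

-- The difference of the two quadratic equations is (J - T) U = V · (J - T)(q²). Both J and T begin
-- with 16q, so U begins with 32q, as the uniqueness lemma demands.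
jacobi : J ≈ T
jacobi = begin
  J              ≈⟨ solve 2 (λ x y → x := (x :- y) :+ y) ≈-refl J T ⟩
  (J ⊖ T) ⊕ T    ≈⟨ ⊕-cong (·≈·dil⇒≈0 (J ⊖ T) U V base U₀ (λ U₁≡0 → 32≢0 (trans (sym U₁) U₁≡0)) E-dil) ≈-refl ⟩
  zeroS ⊕ T      ≈⟨ coeffs (λ n → ℤ.+-identityˡ (T n)) ⟩
  T              ∎
  where
  U = (J ⊕ T) · F₄ ^ 8
  V = const (+ 16) · (G₂ · F₂) ^ 8
  32≢0 : + 32 ≢ + 0
  32≢0 ()
  E-dil : (J ⊖ T) · U ≈ V · dil (J ⊖ T)
  E-dil = begin
    (J ⊖ T) · U                          ≈⟨ solve 3 (λ x y z → (x :- y) :* ((x :+ y) :* z) := x :^ 2 :* z :- y :^ 2 :* z) ≈-refl J T (F₄ ^ 8) ⟩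
    J ^ 2 · F₄ ^ 8 ⊖ T ^ 2 · F₄ ^ 8      ≈⟨ ⊖-cong J²-dil T²-dil ⟩
    V · dil J ⊖ V · dil T                ≈⟨ solve 3 (λ v x y → v :* x :- v :* y := v :* (x :- y)) ≈-refl V (dil J) (dil T) ⟩
    V · (dil J ⊖ dil T)                  ≈⟨ ·-cong ≈-refl (dil-⊖ J T) ⟨
    V · dil (J ⊖ T)                      ∎
  -- `_^_` is built on the opaque product and does not compute; `pow` does, so low coefficients can
  -- be checked by `refl`.
  by-pow : ∀ a n {z} → pow a 8 n ≡ z → (a ^ 8) n ≡ z
  by-pow a n eq = trans (sym (coeff (pow≈^ a 8) n)) eq
  J₀ : J 0 ≡ + 0
  J₀ = cong₂ _-ᶻ_ (by-pow G₁ 0 refl) (by-pow F₁ 0 refl)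
  J₁ : J 1 ≡ + 16
  J₁ = cong₂ _-ᶻ_ (by-pow G₁ 1 refl) (by-pow F₁ 1 refl)
  F₄⁸₀ : (F₄ ^ 8) 0 ≡ + 1
  F₄⁸₀ = ^-zero {F₄} refl 8
  T₀ : T 0 ≡ + 0
  T₀ = trans (·-zero (const (+ 16)) (q · F₄ ^ 8)) (cong (+ 16 *ᶻ_) (·-zero q (F₄ ^ 8)))
  T₁ : T 1 ≡ + 16
  T₁ = trans (coeff (const-· (+ 16) (q · F₄ ^ 8)) 1) (cong (+ 16 *ᶻ_) (trans (q·-suc (F₄ ^ 8) 0) F₄⁸₀))
  -- Degree 1 has to be checked by hand: a lowest term of degree 1 would give degree 2 on both sides
  -- of `E-dil`, without conflict.
  base : J ⊖ T ≈[ 1 ] zeroS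
  base = coeffs≤ λ { zero _ → cong₂ _-ᶻ_ J₀ T₀ ; (suc zero) _ → cong₂ _-ᶻ_ J₁ T₁ ; (suc (suc _)) (s≤s ()) }
  U₀ : U 0 ≡ + 0
  U₀ = trans (·-zero (J ⊕ T) (F₄ ^ 8)) (cong (_*ᶻ (F₄ ^ 8) 0) (cong₂ _+ᶻ_ J₀ T₀))
  U₁ : U 1 ≡ + 32
  U₁ = ≡.begin
    U 1
      ≡.≡⟨ ·-suc (J ⊕ T) (F₄ ^ 8) 0 ⟩
    (J ⊕ T) 0 *ᶻ (F₄ ^ 8) 1 +ᶻ (tail (J ⊕ T) · F₄ ^ 8) 0
      ≡.≡⟨ cong₂ _+ᶻ_ (cong (_*ᶻ (F₄ ^ 8) 1) (cong₂ _+ᶻ_ J₀ T₀)) (·-zero (tail (J ⊕ T)) (F₄ ^ 8)) ⟩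
    + 0 +ᶻ (J ⊕ T) 1 *ᶻ (F₄ ^ 8) 0
      ≡.≡⟨ cong (+ 0 +ᶻ_) (cong₂ _*ᶻ_ (cong₂ _+ᶻ_ J₁ T₁) F₄⁸₀) ⟩
    + 32 ≡.∎

-- Odd parts

sgn-odd : ∀ a n → sgn a (suc (n + n)) ≡ -ᶻ a (suc (n + n))
sgn-odd a n = cong -ᶻ_ (even (tail a) n)
  where
  even : ∀ a n → sgn a (n + n) ≡ a (n + n)
  even a zero    = refl
  even a (suc n) = ≡.begin
    -ᶻ sgn (tail a) (n + suc n)          ≡.≡⟨ cong (λ m → -ᶻ sgn (tail a) m) (ℕ.+-suc n n) ⟩
    -ᶻ (-ᶻ sgn (tail (tail a)) (n + n))  ≡.≡⟨ ℤ.neg-involutive _ ⟩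
    sgn (tail (tail a)) (n + n)          ≡.≡⟨ even (tail (tail a)) n ⟩
    a (2 + (n + n))                      ≡.≡⟨ cong (λ m → a (suc m)) (ℕ.+-suc n n) ⟨
    a (suc n + suc n)                    ≡.∎

-- In degree 2n + 1 the left side is twice the coefficient of a, and q b(q²) has coefficient b n;
-- the 2 cancels in ℤ.
odd-part : ∀ k → a ⊖ sgn a ≈ const (+ 2 *ᶻ k) · (q · dil b) → ∀ n → a (2 * n + 1) ≡ k *ᶻ b n
odd-part {a} {b} k p n = trans (cong a 2n+1) (ℤ.*-cancelˡ-≡ (+ 2) (a m) (k *ᶻ b n) (≡.begin
  + 2 *ᶻ a m                               ≡.≡⟨ two*x (a m) ⟩
  a m +ᶻ a m                               ≡.≡⟨ cong (a m +ᶻ_) (ℤ.neg-involutive (a m)) ⟨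
  a m -ᶻ (-ᶻ a m)                          ≡.≡⟨ cong (λ t → a m -ᶻ t) (sgn-odd a n) ⟨
  a m -ᶻ sgn a m                           ≡.≡⟨ coeff p m ⟩
  (const (+ 2 *ᶻ k) · (q · dil b)) m       ≡.≡⟨ coeff (const-· (+ 2 *ᶻ k) (q · dil b)) m ⟩
  + 2 *ᶻ k *ᶻ (q · dil b) m                ≡.≡⟨ cong (+ 2 *ᶻ k *ᶻ_) (trans (q·-suc (dil b) (n + n)) (dil-double b n)) ⟩
  + 2 *ᶻ k *ᶻ b n                          ≡.≡⟨ ℤ.*-assoc (+ 2) k (b n) ⟩
  + 2 *ᶻ (k *ᶻ b n)                        ≡.∎))
  where
  m = suc (n + n)
  2n+1 : 2 * n + 1 ≡ m
  2n+1 = trans (ℕ.+-comm (2 * n) 1) (cong suc (double n))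
  two*x : ∀ x → + 2 *ᶻ x ≡ x +ᶻ x
  two*x x = trans (ℤ.*-distribʳ-+ x (+ 1) (+ 1)) (cong₂ _+ᶻ_ (ℤ.*-identityˡ x) (ℤ.*-identityˡ x))

-- Reciprocals, and the odd parts of 1/f₁⁸ and f₂¹⁶/f₁²⁴

I₁ I₂ I₁⁻ : Series
I₁  = inv F₁
-- A dilation rather than `inv F₂`, so that dilating powers of `I₁` yields powers of `I₂` with no
-- lemma on `inv`.
I₂  = dil I₁
I₁⁻ = sgn I₁

F₁·I₁ : F₁ · I₁ ≈ one
F₁·I₁ = inv-inverse {F₁} refl

G₁·I₁⁻ : G₁ · I₁⁻ ≈ one
G₁·I₁⁻ = ≈-trans (≈-sym (sgn-· F₁ I₁)) (≈-trans (sgn-cong F₁·I₁) sgn-one)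

F₂·I₂ : F₂ · I₂ ≈ one
F₂·I₂ = ≈-trans (·-cong f₂≈dil-f₁ ≈-refl)
  (≈-trans (≈-sym (dil-· F₁ I₁)) (≈-trans (dil-cong F₁·I₁) (dil-mono 0)))

-- All exponents in the theorem are multiples of 8, so these eighth powers, together with q and the
-- relation w v = 1, express everything that follows.
w v g x y : Series
w = F₂ ^ 8
v = I₂ ^ 8
g = F₄ ^ 8
x = I₁ ^ 8
y = I₁⁻ ^ 8

^8-inverse : a · b ≈ one → a ^ 8 · b ^ 8 ≈ one
^8-inverse {a} {b} p = ≈-trans (≈-sym (^-distrib-* a b 8)) (≈-trans (^-congˡ 8 p) (one-^ 8))

w·v : w · v ≈ one
w·v = ^8-inverse F₂·I₂

sgn-x : sgn x ≈ y
sgn-x = sgn-^ I₁ 8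

-- The eighth power of `f-sgn` solved for 1/(f₁ f₁(-q)) = f₄/f₂³.
x·y : x · y ≈ g · v ^ 3
x·y = begin
  I₁ ^ 8 · I₁⁻ ^ 8           ≈⟨ ^-distrib-* I₁ I₁⁻ 8 ⟨
  (I₁ · I₁⁻) ^ 8             ≈⟨ ^-congˡ 8 I₁·I₁⁻ ⟩
  (F₄ · I₂ ^ 3) ^ 8          ≈⟨ ^-distrib-* F₄ (I₂ ^ 3) 8 ⟩
  g · (I₂ ^ 3) ^ 8           ≈⟨ ·-cong ≈-refl (≈-trans (^-assocʳ I₂ 3 8) (≈-sym (^-assocʳ I₂ 8 3))) ⟩
  g · v ^ 3                  ∎
  where
  I₁·I₁⁻ : I₁ · I₁⁻ ≈ F₄ · I₂ ^ 3
  I₁·I₁⁻ = begin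
    I₁ · I₁⁻                                    ≈⟨ solve 1 (λ t → t := t :* :1 :^ 3) ≈-refl (I₁ · I₁⁻) ⟩
    I₁ · I₁⁻ · one ^ 3                          ≈⟨ ·-cong ≈-refl (^-congˡ 3 F₂·I₂) ⟨
    I₁ · I₁⁻ · (F₂ · I₂) ^ 3                    ≈⟨ solve 3 (λ t a b → t :* (a :* b) :^ 3 := a :^ 3 :* (t :* b :^ 3)) ≈-refl (I₁ · I₁⁻) F₂ I₂ ⟩
    F₂ ^ 3 · (I₁ · I₁⁻ · I₂ ^ 3)                ≈⟨ ·-cong f-sgn ≈-refl ⟨
    F₁ · G₁ · F₄ · (I₁ · I₁⁻ · I₂ ^ 3)
      ≈⟨ solve 6 (λ a b c i j k → a :* b :* c :* (i :* j :* k) := (a :* i) :* (b :* j) :* (c :* k)) ≈-refl F₁ G₁ F₄ I₁ I₁⁻ (I₂ ^ 3) ⟩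
    (F₁ · I₁) · (G₁ · I₁⁻) · (F₄ · I₂ ^ 3)      ≈⟨ ·-cong (·-cong F₁·I₁ G₁·I₁⁻) ≈-refl ⟩
    one · one · (F₄ · I₂ ^ 3)                   ≈⟨ solve 1 (λ t → :1 :* :1 :* t := t) ≈-refl (F₄ · I₂ ^ 3) ⟩
    F₄ · I₂ ^ 3                                 ∎

-- Over the common denominator, 1/f₁⁸ - 1/f₁(-q)⁸ is J times x y.
x⊖y : x ⊖ y ≈ const (+ 16) · (q · (g ^ 2 · v ^ 3))
x⊖y = begin
  x ⊖ y                                        ≈⟨ solve 2 (λ x y → x :- y := x :* :1 :- y :* :1) ≈-refl x y ⟩
  x · one ⊖ y · one                            ≈⟨ ⊖-cong (·-cong ≈-refl (^8-inverse G₁·I₁⁻)) (·-cong ≈-refl (^8-inverse F₁·I₁)) ⟨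
  x · (G₁ ^ 8 · y) ⊖ y · (F₁ ^ 8 · x)          ≈⟨ solve 4 (λ x y s t → x :* (s :* y) :- y :* (t :* x) := x :* y :* (s :- t)) ≈-refl x y (G₁ ^ 8) (F₁ ^ 8) ⟩
  x · y · J                                    ≈⟨ ·-cong x·y jacobi ⟩
  g · v ^ 3 · (const (+ 16) · (q · g))         ≈⟨ solve 4 (λ g v k q → g :* v :^ 3 :* (k :* (q :* g)) := k :* (q :* (g :^ 2 :* v :^ 3))) ≈-refl g v (const (+ 16)) q ⟩
  const (+ 16) · (q · (g ^ 2 · v ^ 3))         ∎

quotient : ℕ → ℕ → Series
quotient m n = w ^ m · x ^ n

quotient≈ : ∀ m n {M N} → M ≡ 8 * m → N ≡ 8 * n → pow (f 2) M ⊛ inv (pow (f 1) N) ≈ quotient m n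
quotient≈ m n refl refl = begin
  pow (f 2) (8 * m) ⊛ inv (pow (f 1) (8 * n))  ≈⟨ ⊛≈· _ _ ⟩
  pow (f 2) (8 * m) · inv (pow (f 1) (8 * n))  ≈⟨ ·-cong (pow≈^ F₂ (8 * m)) (inv-pow {F₁} refl (8 * n)) ⟩
  F₂ ^ (8 * m) · I₁ ^ (8 * n)                  ≈⟨ ·-cong (^-assocʳ F₂ 8 m) (^-assocʳ I₁ 8 n) ⟨
  quotient m n                                 ∎

dil-quotient : ∀ m n → dil (quotient m n) ≈ g ^ m · v ^ n
dil-quotient m n = ≈-trans (dil-· (w ^ m) (x ^ n)) (·-cong (dil-^^ F₂ m) (dil-^^ I₁ n))
  where
  dil-^^ : ∀ a n → dil ((a ^ 8) ^ n) ≈ (dil a ^ 8) ^ n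
  dil-^^ a n = ≈-trans (dil-^ (a ^ 8) n) (^-congˡ n (dil-^ a 8))

p8-odd : ∀ n → p8 (2 * n + 1) ≡ + 8 *ᶻ quotient 2 3 n
p8-odd n = trans (coeff (inv-pow {F₁} refl 8) (2 * n + 1)) (odd-part {x} {quotient 2 3} (+ 8) (begin
  x ⊖ sgn x                                    ≈⟨ ⊖-cong {x} ≈-refl sgn-x ⟩
  x ⊖ y                                        ≈⟨ x⊖y ⟩
  const (+ 16) · (q · (g ^ 2 · v ^ 3))         ≈⟨ ·-cong ≈-refl (·-cong ≈-refl (dil-quotient 2 3)) ⟨
  const (+ 16) · (q · dil (quotient 2 3))      ∎) n)

quotient-odd : ∀ n → quotient 2 3 (2 * n + 1) ≡ + 1 *ᶻ (const (+ 24) · quotient 3 4 ⊕ const (+ 2048) · (q · quotient 6 7)) n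
quotient-odd = odd-part {quotient 2 3} {const (+ 24) · quotient 3 4 ⊕ const (+ 2048) · (q · quotient 6 7)} (+ 1) (begin
  w ^ 2 · x ^ 3 ⊖ sgn (w ^ 2 · x ^ 3)
    ≈⟨ ⊖-cong {w ^ 2 · x ^ 3} ≈-refl (≈-trans (sgn-· (w ^ 2) (x ^ 3))
         (·-cong sgn-w² (≈-trans (sgn-^ x 3) (^-congˡ 3 sgn-x)))) ⟩
  w ^ 2 · x ^ 3 ⊖ w ^ 2 · y ^ 3
    ≈⟨ solve 3 (λ w x y → w :^ 2 :* x :^ 3 :- w :^ 2 :* y :^ 3
         := w :^ 2 :* ((x :- y) :* ((x :- y) :^ 2 :+ con (+ 3) :* (x :* y)))) ≈-refl w x y ⟩
  w ^ 2 · ((x ⊖ y) · ((x ⊖ y) ^ 2 ⊕ const (+ 3) · (x · y)))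
    ≈⟨ ·-cong ≈-refl (·-cong x⊖y (⊕-cong (^-congˡ 2 x⊖y) (·-cong ≈-refl x·y))) ⟩
  w ^ 2 · (X · (X ^ 2 ⊕ const (+ 3) · (g · v ^ 3)))
    -- The constants are 3 · 16 = 2 · 24 and 16³ = 2 · 2048. The powers v⁶ and v⁹ each give up v² to
    -- pair with w², leaving v⁴ and v⁷.
    ≈⟨ solve 4 (λ w v g q →
         let X = con (+ 16) :* (q :* (g :^ 2 :* v :^ 3)) in
         w :^ 2 :* (X :* (X :^ 2 :+ con (+ 3) :* (g :* v :^ 3)))
         := con (+ 2) :* (q :* (con (+ 24) :* (g :^ 3 :* ((w :* v) :^ 2 :* v :^ 4))
              :+ con (+ 2048) :* ((q :* q) :* (g :^ 6 :* ((w :* v) :^ 2 :* v :^ 7)))))) ≈-refl w v g q ⟩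
  Z ((w · v) ^ 2 · v ^ 4) ((w · v) ^ 2 · v ^ 7)
    ≈⟨ Z-cong (w·v-cancel (v ^ 4)) (w·v-cancel (v ^ 7)) ⟩
  Z (v ^ 4) (v ^ 7)
    ≈⟨ ·-cong {const (+ 2)} ≈-refl (·-cong ≈-refl dil-Z) ⟨
  const (+ 2 *ᶻ + 1) · (q · dil (const (+ 24) · quotient 3 4 ⊕ const (+ 2048) · (q · quotient 6 7))) ∎)
  where
  X = const (+ 16) · (q · (g ^ 2 · v ^ 3))
  Z : Series → Series → Series
  Z s t = const (+ 2) · (q · (const (+ 24) · (g ^ 3 · s) ⊕ const (+ 2048) · ((q · q) · (g ^ 6 · t))))
  Z-cong : a ≈ b → c ≈ d → Z a c ≈ Z b d
  Z-cong p r = ·-cong ≈-refl (·-cong ≈-refl (⊕-cong (·-cong ≈-refl (·-cong ≈-refl p))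
    (·-cong ≈-refl (·-cong ≈-refl (·-cong ≈-refl r)))))
  w·v-cancel : ∀ t → (w · v) ^ 2 · t ≈ t
  w·v-cancel t = ≈-trans (·-cong (≈-trans (^-congˡ 2 w·v) (one-^ 2)) ≈-refl) (·-identityˡ t)
  sgn-w² : sgn (w ^ 2) ≈ w ^ 2
  sgn-w² = ≈-trans (sgn-^ w 2) (^-congˡ 2 (≈-trans (sgn-^ F₂ 8) (^-congˡ 8 sgn-F₂)))
  dil-Z : dil (const (+ 24) · quotient 3 4 ⊕ const (+ 2048) · (q · quotient 6 7))
          ≈ const (+ 24) · (g ^ 3 · v ^ 4) ⊕ const (+ 2048) · ((q · q) · (g ^ 6 · v ^ 7))
  dil-Z = ≈-trans (dil-⊕ (const (+ 24) · quotient 3 4) (const (+ 2048) · (q · quotient 6 7))) (⊕-cong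
    (≈-trans (dil-· (const (+ 24)) (quotient 3 4)) (·-cong (dil-const (+ 24)) (dil-quotient 3 4)))
    (≈-trans (dil-· (const (+ 2048)) (q · quotient 6 7)) (·-cong (dil-const (+ 2048))
      (≈-trans (dil-· q (quotient 6 7)) (·-cong (≈-trans (dil-mono 1) (≈-sym (mono-+ 1 1))) (dil-quotient 6 7))))))

theorem3p1 : ((n : ℕ) → p8 (2 * n + 1) ≡ scale (+ 8) (pow (f 2) 16 ⊛ inv (pow (f 1) 24)) n)
    × ((n : ℕ) → p8 (4 * n + 3) ≡ (scale (+ 192) (pow (f 2) 24 ⊛ inv (pow (f 1) 32)) ⊕ scale (+ 16384) (q ⊛ pow (f 2) 48 ⊛ inv (pow (f 1) 56))) n)
theorem3p1 = part₁ , part₂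
  where
  part₁ : ∀ n → p8 (2 * n + 1) ≡ + 8 *ᶻ (pow (f 2) 16 ⊛ inv (pow (f 1) 24)) n
  part₁ n = trans (p8-odd n) (cong (+ 8 *ᶻ_) (sym (coeff (quotient≈ 2 3 {16} {24} refl refl) n)))

  4n+3 : ∀ n → 4 * n + 3 ≡ 2 * (2 * n + 1) + 1
  4n+3 n = ≡.begin
    4 * n + 3               ≡.≡⟨ ℕ.+-assoc (4 * n) 2 1 ⟨
    4 * n + 2 + 1           ≡.≡⟨ cong (λ m → m + 2 + 1) (ℕ.*-assoc 2 2 n) ⟩
    2 * (2 * n) + 2 * 1 + 1 ≡.≡⟨ cong (_+ 1) (ℕ.*-distribˡ-+ 2 (2 * n) 1) ⟨
    2 * (2 * n + 1) + 1     ≡.∎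

  q⊛-quotient : q ⊛ pow (f 2) 48 ⊛ inv (pow (f 1) 56) ≈ q · quotient 6 7
  q⊛-quotient = begin
    q ⊛ pow (f 2) 48 ⊛ inv (pow (f 1) 56)   ≈⟨ ⊛-assoc q (pow (f 2) 48) (inv (pow (f 1) 56)) ⟩
    q ⊛ (pow (f 2) 48 ⊛ inv (pow (f 1) 56)) ≈⟨ ⊛≈· q (pow (f 2) 48 ⊛ inv (pow (f 1) 56)) ⟩
    q · (pow (f 2) 48 ⊛ inv (pow (f 1) 56)) ≈⟨ ·-cong ≈-refl (quotient≈ 6 7 {48} {56} refl refl) ⟩
    q · quotient 6 7                  ∎

  part₂ : ∀ n → p8 (4 * n + 3) ≡ + 192 *ᶻ (pow (f 2) 24 ⊛ inv (pow (f 1) 32)) n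
                              +ᶻ + 16384 *ᶻ (q ⊛ pow (f 2) 48 ⊛ inv (pow (f 1) 56)) n
  part₂ n = ≡.begin
    p8 (4 * n + 3)
      ≡.≡⟨ cong p8 (4n+3 n) ⟩
    p8 (2 * (2 * n + 1) + 1)
      ≡.≡⟨ p8-odd (2 * n + 1) ⟩
    + 8 *ᶻ quotient 2 3 (2 * n + 1)
      ≡.≡⟨ cong (+ 8 *ᶻ_) (trans (quotient-odd n) (ℤ.*-identityˡ _)) ⟩
    + 8 *ᶻ ((const (+ 24) · A) n +ᶻ (const (+ 2048) · B) n)
      ≡.≡⟨ cong (+ 8 *ᶻ_) (cong₂ _+ᶻ_ (coeff (const-· (+ 24) A) n) (coeff (const-· (+ 2048) B) n)) ⟩
    + 8 *ᶻ (+ 24 *ᶻ A n +ᶻ + 2048 *ᶻ B n)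
      ≡.≡⟨ ℤ.*-distribˡ-+ (+ 8) (+ 24 *ᶻ A n) (+ 2048 *ᶻ B n) ⟩
    + 8 *ᶻ (+ 24 *ᶻ A n) +ᶻ + 8 *ᶻ (+ 2048 *ᶻ B n)
      ≡.≡⟨ cong₂ _+ᶻ_ (ℤ.*-assoc (+ 8) (+ 24) (A n)) (ℤ.*-assoc (+ 8) (+ 2048) (B n)) ⟨
    + 192 *ᶻ A n +ᶻ + 16384 *ᶻ B n
      ≡.≡⟨ cong₂ _+ᶻ_ (cong (+ 192 *ᶻ_) (coeff (quotient≈ 3 4 {24} {32} refl refl) n)) (cong (+ 16384 *ᶻ_) (coeff q⊛-quotient n)) ⟨
    + 192 *ᶻ (pow (f 2) 24 ⊛ inv (pow (f 1) 32)) n +ᶻ + 16384 *ᶻ (q ⊛ pow (f 2) 48 ⊛ inv (pow (f 1) 56)) n ≡.∎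
    where
    A = quotient 3 4
    B = q · quotient 6 7
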